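{- With the antimorphism $S$ defined below, for every $x \in \textsf{ParSym}$ one has $\nabla\big((S\otimes \mathrm{id})(\Delta x)\big) = \eta(\varepsilon(x)) = \nabla\big((\mathrm{id}\otimes S)(\Delta x)\big)$; that is, $S$ is an antipode and $\textsf{ParSym}$ is a Hopf algebra.
   Context: Partition diagrams of order $k$ are set partitions of $\{1,\ldots,k,1',\ldots,k'\}$; $A_k$ is the set of them, $A_0=\{\varnothing\}$. For $\pi$ of order $k$, $\rho$ of order $l$: $\pi\otimes\rho$ has as blocks those of $\pi$ and those of $\rho$ shifted ($i\mapsto i+k$, $i'\mapsto(i+k)'$). A diagram is $\otimes$-irreducible if it is not $\rho^{(1)}\otimes\rho^{(2)}$ with both factors nonempty. For nonempty $\pi,\rho$ (orders $k,l$), $\pi\bullet\rho$ is obtained from $\pi\otimes\rho$ by merging the block containing $k'$ with the block containing $(k+1)'$; $\varnothing\bullet\rho=\rho$, $\pi\bullet\varnothing=\pi$. Over a field $\mathbbm{k}$, $\textsf{ParSym}$ has basis $\{\textsf{H}_\pi : \pi\in A_i, i\geq0\}$, product $\nabla$ given by $\textsf{H}_\pi\textsf{H}_\rho=\textsf{H}_{\pi\otimes\rho}$, unit $\eta(1)=\textsf{H}_\varnothing$; it is free on the $\textsf{H}_\pi$, $\pi$ nonempty $\otimes$-irreducible. Counit: $\varepsilon(\textsf{H}_\varnothing)=1$, $\varepsilon(\textsf{H}_\pi)=0$ for $\pi$ nonempty. Coproduct: the algebra morphism with $\Delta\textsf{H}_\varnothing=\textsf{H}_\varnothing\otimes\textsf{H}_\varnothing$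 and, for nonempty $\otimes$-irreducible $\pi$, $\Delta\textsf{H}_\pi=\sum\textsf{H}_{G_1}\otimes\textsf{H}_{G_2}$ over ordered pairs $(G_1,G_2)$ of diagrams, each $\varnothing$ or $\otimes$-irreducible, with $G_1\bullet G_2=\pi$. The map $S$ is the linear algebra antimorphism ($S(xy)=S(y)S(x)$) with $S(\textsf{H}_\varnothing)=\textsf{H}_\varnothing$ and, for nonempty $\otimes$-irreducible $\pi$, $S(\textsf{H}_\pi)=\sum(-1)^\ell\textsf{H}_{\rho^{(1)}}\cdots\textsf{H}_{\rho^{(\ell)}}$, summed over all tuples $(\rho^{(1)},\ldots,\rho^{(\ell)})$, $\ell\geq1$, of nonempty diagrams with $\rho^{(1)}\bullet\cdots\bullet\rho^{(\ell)}=\pi$. -}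

module Defs where

open import Level using () renaming (suc to lsuc; _⊔_ to _⊔ˡ_)
open import Data.Bool using (Bool; true; false; if_then_else_; _∧_; _∨_; not)
open import Data.Nat using (ℕ; zero; suc; _⊔_; _≡ᵇ_)
open import Data.Nat using () renaming (_+_ to _+ℕ_)
open import Data.Nat.Properties using () renaming (_≟_ to _≟ℕ_)
open import Data.Product using (_×_; _,_; Σ; ∃; proj₁; proj₂)
open import Data.Maybe using (Maybe; just; nothing)
open import Data.List using (List; []; _∷_; _++_; map; concatMap; foldr; length; upTo; applyUpTo; _∷ʳ_; reverse; filterᵇ)
open import Data.Bool.ListAction using (any)
import Data.List.Properties as LP
import Data.Product.Properties as PP
open import Relation.Nullary using (¬_; does)
open import Relation.Binary.PropositionalEquality using (_≡_)
open import Relation.Binary.Definitions using (DecidableEquality)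
open import Algebra.Bundles using (CommutativeRing)

record Field c ℓ : Set (lsuc (c ⊔ˡ ℓ)) where
  field
    commutativeRing : CommutativeRing c ℓ
  open CommutativeRing commutativeRing public
  field
    0≉1     : ¬ (0# ≈ 1#)
    inverse : ∀ x → ¬ (x ≈ 0#) → ∃ λ y → x * y ≈ 1#

-- Partition diagrams.
-- A (raw) diagram of order k is a list of k columns; column i is the pair
-- (label of the block containing i , label of the block containing i').
-- Two points are in the same block iff they carry the same label.  Every
-- raw diagram represents a set partition of {1..k,1'..k'}; two raw
-- diagrams represent the same partition iff their normal forms (labels
-- renamed to a restricted growth string read in the order 1,1',2,2',...)
-- coincide.  The empty list is the empty diagram ∅ (the unique element of A₀).

Diagram : Set
Diagram = List (ℕ × ℕ)

order : Diagram → ℕ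
order = length

_≟D_ : DecidableEquality Diagram
_≟D_ = LP.≡-dec (PP.≡-dec _≟ℕ_ _≟ℕ_)

flatten : Diagram → List ℕ
flatten [] = []
flatten ((a , b) ∷ d) = a ∷ b ∷ flatten d

pairUp : List ℕ → Diagram
pairUp (a ∷ b ∷ xs) = (a , b) ∷ pairUp xs
pairUp _ = []

lookupA : List (ℕ × ℕ) → ℕ → Maybe ℕ
lookupA [] x = nothing
lookupA ((y , v) ∷ as) x = if x ≡ᵇ y then just v else lookupA as x

relabel : List (ℕ × ℕ) → ℕ → List ℕ → List ℕ
relabel as n [] = []
relabel as n (x ∷ xs) with lookupA as x
... | just v  = v ∷ relabel as n xs
... | nothing = n ∷ relabel ((x , n) ∷ as) (suc n) xs

norm : Diagram → Diagram
norm d = pairUp (relabel [] 0 (flatten d))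

_≈D_ : Diagram → Diagram → Bool
d ≈D e = does (norm d ≟D norm e)

maxLabel : Diagram → ℕ
maxLabel d = foldr _⊔_ 0 (flatten d)

shift : ℕ → Diagram → Diagram
shift o = map (λ { (a , b) → (o +ℕ a , o +ℕ b) })

_⊗D_ : Diagram → Diagram → Diagram
π ⊗D ρ = norm (π ++ shift (suc (maxLabel π)) ρ)

rename : ℕ → ℕ → Diagram → Diagram
rename b a = map (λ { (x , y) → (r x , r y) })
  where r : ℕ → ℕ
        r z = if z ≡ᵇ b then a else z

lastBottom : ℕ × ℕ → Diagram → ℕ
lastBottom (_ , b) [] = b
lastBottom _ (c ∷ d) = lastBottom c d

-- π • ρ : π ⊗ ρ with the blocks of k' and (k+1)' merged
_•D_ : Diagram → Diagram → Diagram
[] •D ρ = norm ρ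
(c ∷ π) •D [] = norm (c ∷ π)
(c ∷ π) •D ((t , b) ∷ ρ) =
  let o = suc (maxLabel (c ∷ π)) in
  norm (rename (o +ℕ b) (lastBottom c π) ((c ∷ π) ++ shift o ((t , b) ∷ ρ)))

-- π = ρ¹ ⊗ ρ² with ρ¹ the first j columns and ρ² the remaining ones
-- (any decomposition π = ρ¹ ⊗ ρ² with order ρ¹ = j is of this form).
splitsAt : ℕ → Diagram → Bool
splitsAt j π = (Data.List.take j π ⊗D Data.List.drop j π) ≈D π

reducible : Diagram → Bool
reducible π = any (λ j → splitsAt (suc j) π) (upTo (order π ∸' 1))
  where _∸'_ : ℕ → ℕ → ℕ
        m ∸' n = m Data.Nat.∸ n

nonempty : Diagram → Bool
nonempty [] = false
nonempty (_ ∷ _) = true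

irreducible : Diagram → Bool
irreducible π = nonempty π ∧ not (reducible π)

-- factorisation π = π₁ ⊗ ⋯ ⊗ πₘ into nonempty ⊗-irreducible diagrams,
-- splitting off the shortest nonempty ⊗-factor each time
factorsAcc : Diagram → Diagram → List Diagram
factorsAcc [] [] = []
factorsAcc (c ∷ pre) [] = norm (c ∷ pre) ∷ []
factorsAcc pre (c ∷ rest) with (pre ∷ʳ c) | nonempty rest ∧ ((norm (pre ∷ʳ c) ⊗D norm rest) ≈D (pre ∷ʳ c ++ rest))
... | pre' | true  = norm pre' ∷ factorsAcc [] rest
... | pre' | false = factorsAcc pre' rest

factors : Diagram → List Diagram
factors π = factorsAcc [] (norm π)

-- enumeration of A_k (all restricted growth strings of length 2k)
rgs : ℕ → ℕ → List (List ℕ)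
rgs zero m = [] ∷ []
rgs (suc n) m = concatMap (λ a → map (a ∷_) (rgs n (if a ≡ᵇ m then suc m else m))) (upTo (suc m))

diagrams : ℕ → List Diagram
diagrams k = map pairUp (rgs (k +ℕ k) 0)

compsS : ℕ → List (List ℕ)
compsS zero = (1 ∷ []) ∷ []
compsS (suc n) = concatMap (λ c → (1 ∷ c) ∷ bump c ∷ []) (compsS n)
  where bump : List ℕ → List ℕ
        bump [] = []
        bump (h ∷ t) = suc h ∷ t

comps : ℕ → List (List ℕ)
comps zero = [] ∷ []
comps (suc n) = compsS n

tuplesOf : List ℕ → List (List Diagram)
tuplesOf [] = [] ∷ []
tuplesOf (a ∷ c) = concatMap (λ d → map (d ∷_) (tuplesOf c)) (diagrams a)

tuples : ℕ → List (List Diagram)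
tuples k = concatMap tuplesOf (comps k)

bulletAll : List Diagram → Diagram
bulletAll [] = []
bulletAll (d ∷ ds) = d •D bulletAll ds

-- ParSym over a commutative ring (instantiated with a field below).
-- An element is a finite formal combination  Σ cᵢ H_{πᵢ}, equality is
-- equality of all coefficients (with respect to the partition represented).

module ParSym {c ℓ} (R : CommutativeRing c ℓ) where
  open CommutativeRing R renaming (Carrier to K)

  V : Set c
  V = List (K × Diagram)

  -- ParSym ⊗ ParSym, basis H_π ⊗ H_ρ
  T : Set c
  T = List (K × Diagram × Diagram)

  sumK : List K → K
  sumK = foldr _+_ 0#

  coeff : V → Diagram → K
  coeff x π = sumK (map proj₁ (filterᵇ (λ p → proj₂ p ≈D π) x))

  coeffT : T → Diagram → Diagram → K
  coeffT x π ρ = sumK (map proj₁ (filterᵇ (λ p → (proj₁ (proj₂ p) ≈D π) ∧ (proj₂ (proj₂ p) ≈D ρ)) x))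

  _≋_ : V → V → Set ℓ
  x ≋ y = ∀ π → coeff x π ≈ coeff y π

  H : Diagram → V
  H π = (1# , π) ∷ []

  scale : K → V → V
  scale a = map (λ { (b , π) → (a * b , π) })

  scaleT : K → T → T
  scaleT a = map (λ { (b , p) → (a * b , p) })

  _·_ : V → V → V
  x · y = concatMap (λ { (a , π) → map (λ { (b , ρ) → (a * b , π ⊗D ρ) }) y }) x

  ∇ : T → V
  ∇ = map (λ { (a , π , ρ) → (a , π ⊗D ρ) })

  η : K → V
  η a = (a , []) ∷ []

  ε : V → K
  ε x = sumK (map proj₁ (filterᵇ (λ p → order (proj₂ p) ≡ᵇ 0) x))

  _·T_ : T → T → T
  x ·T y = concatMap (λ { (a , π , ρ) → map (λ { (b , π' , ρ') → (a * b , π ⊗D π' , ρ ⊗D ρ') }) y }) x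

  oneT : T
  oneT = (1# , [] , []) ∷ []

  emptyOrIrr : Diagram → Bool
  emptyOrIrr d = not (nonempty d) ∨ irreducible d

  ΔIrr : Diagram → T
  ΔIrr π = concatMap (λ a →
      concatMap (λ G₁ → concatMap (λ G₂ →
        if emptyOrIrr G₁ ∧ emptyOrIrr G₂ ∧ ((G₁ •D G₂) ≈D π)
          then (1# , G₁ , G₂) ∷ [] else [])
        (diagrams (order π Data.Nat.∸ a)))
      (diagrams a))
    (upTo (suc (order π)))

  -- Δ is the algebra morphism extending ΔIrr (Δ H_∅ = H_∅ ⊗ H_∅)
  ΔH : Diagram → T
  ΔH π = foldr (λ f t → ΔIrr f ·T t) oneT (factors π)

  Δ : V → T
  Δ x = concatMap (λ { (a , π) → scaleT a (ΔH π) }) x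

  sign : ℕ → K
  sign zero = 1#
  sign (suc n) = - sign n

  SIrr : Diagram → V
  SIrr π = concatMap (λ ρs →
      if bulletAll ρs ≈D π
        then (sign (length ρs) , foldr _⊗D_ [] ρs) ∷ [] else [])
    (tuples (order π))

  -- S is the antimorphism extending SIrr (S H_∅ = H_∅)
  SH : Diagram → V
  SH π = foldr (λ f v → v · SIrr f) (H []) (factors π)

  S : V → V
  S x = concatMap (λ { (a , π) → scale a (SH π) }) x

  S⊗id : T → T
  S⊗id = concatMap (λ { (a , π , ρ) → map (λ { (b , σ) → (a * b , σ , ρ) }) (SH π) })

  id⊗S : T → T
  id⊗S = concatMap (λ { (a , π , ρ) → map (λ { (b , σ) → (a * b , π , σ) }) (SH ρ) })

{-# OPTIONS --safe #-}

-- Let f be nonempty and ⊗-irreducible.  Substituting the definition of S(H_{G₁}) into the sum of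
-- S(H_{G₁}) H_{G₂} over G₁ • G₂ = f, the pair (G₁, G₂) with G₂ ≠ ∅ contributes the tuples with last entry
-- G₂ and bullet product f, with the sign opposite to the one they have in S(H_f), while G₂ = ∅ contributes
-- S(H_f) itself, so everything cancels; symmetrically for id ⊗ S with first entries.  The general case
-- follows because Δ is multiplicative and S antimultiplicative, which rests on unique ⊗-factorisation.
-- Formal sums are compared by evaluating them against functions of a diagram, coefficients being an instance.

module Submission where

open import Defs
open import Algebra.Bundles using (CommutativeRing)
open import Data.Bool as Bool using (Bool; true; false; if_then_else_; _∧_; not)
open import Data.Empty using (⊥; ⊥-elim)
open import Data.Maybe using (just; nothing; fromMaybe)
open import Data.Nat using (ℕ; zero; suc; _≡ᵇ_; _<_; _≤_; s≤s; s≤s⁻¹; _∸_; _⊔_) renaming (_+_ to _+ℕ_)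
open import Data.Nat.ListAction using (sum)
import Data.Nat.Properties as ℕ
open import Data.Product using (_×_; _,_; ∃; proj₁; proj₂) renaming (map to ×-map)
open import Data.Sum using (_⊎_; inj₁; inj₂; [_,_])
open import Data.Unit using (tt)
open import Data.List using (List; []; _∷_; _++_; map; concatMap; length; _∷ʳ_; foldr; take; drop; upTo; filterᵇ; null; initLast; _∷ʳ′_)
import Data.List.Properties as List
open import Data.List.Membership.DecPropositional ℕ._≟_ using (_∈?_)
open import Data.List.Membership.Propositional using (_∈_; find)
open import Data.List.Membership.Propositional.Properties using (∈-++⁺ˡ; ∈-++⁺ʳ; ∈-++⁻; ∈-map⁻; ∈-upTo⁻)
open import Data.List.Relation.Binary.Disjoint.Propositional using (Disjoint)
open import Data.List.Relation.Unary.All as All using (All; []; _∷_)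
import Data.List.Relation.Unary.All.Properties as All
open import Data.List.Relation.Unary.Any using (here; there)
open import Data.List.Relation.Unary.Any.Properties using (any⁻)
open import Function using (_∘_; id)
open import Level using (Level)
open import Relation.Binary.PropositionalEquality as ≡ using (_≡_; _≢_; cong; cong₂; subst; module ≡-Reasoning)
open import Relation.Nullary using (¬_; yes; no; does)
open import Relation.Nullary.Decidable using (dec-true; dec-false)

-- Relabelling of diagrams

-- Diagrams are label lists that matter only up to renaming, while `⊗D` and `•D` choose fresh labels
-- and then normalise, which hides the structure. The remedy is to pass to representatives of the
-- factors whose labels overlap exactly where blocks should merge: nowhere for `⊗D`, in one label
-- for `•D`. The product is then `norm` of a plain concatenation, and associativity, cuts and
-- factorisation become statements about `++`. The cancellation has to match pairs of
-- irreducible-or-empty diagrams, as in `ΔIrr`, with tuples of arbitrary nonempty diagrams, as in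
-- `SIrr`. This works because a `•D`-factor of an irreducible diagram is itself irreducible or
-- empty, so the tests in `ΔIrr` follow from the product condition. For several factors the two
-- antipode identities are not mirror images: `ΔH` peels off the leading factor, whose contribution
-- to `S ⊗ id` stands in the middle of the product, but whose contribution to `id ⊗ S` encloses
-- everything else. Hence the second identity calls for induction on the factors.

mapD : (ℕ → ℕ) → Diagram → Diagram
mapD f = map (×-map f f)

infix 4 _~_

-- Two raw diagrams represent the same set partition iff each is obtained from the other by a map of labels.
record _~_ (d e : Diagram) : Set where
  constructor relabelling
  field
    to     : ℕ → ℕ
    from   : ℕ → ℕ
    to-≡   : mapD to d ≡ e
    from-≡ : mapD from e ≡ d

open _~_

mapD-id : ∀ d → mapD id d ≡ d
mapD-id = List.map-id

mapD-∘ : ∀ f g d → mapD f (mapD g d) ≡ mapD (f ∘ g) d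
mapD-∘ f g d = ≡.sym (List.map-∘ d)

mapD-++ : ∀ f d e → mapD f (d ++ e) ≡ mapD f d ++ mapD f e
mapD-++ f d e = List.map-++ _ d e

~-refl : ∀ {d} → d ~ d
~-refl {d} = relabelling id id (mapD-id d) (mapD-id d)

~-sym : ∀ {d e} → d ~ e → e ~ d
~-sym (relabelling f g p q) = relabelling g f q p

~-trans : ∀ {c d e} → c ~ d → d ~ e → c ~ e
~-trans {c} {d} {e} (relabelling f g p q) (relabelling f′ g′ p′ q′) = relabelling (f′ ∘ f) (g ∘ g′)
  (≡.trans (≡.sym (mapD-∘ f′ f c)) (≡.trans (cong (mapD f′) p) p′))
  (≡.trans (≡.sym (mapD-∘ g g′ e)) (≡.trans (cong (mapD g) q′) q))

≡⇒~ : ∀ {d e} → d ≡ e → d ~ e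
≡⇒~ ≡.refl = ~-refl

flatten-++ : ∀ d e → flatten (d ++ e) ≡ flatten d ++ flatten e
flatten-++ [] e = ≡.refl
flatten-++ ((a , b) ∷ d) e = cong (λ xs → a ∷ b ∷ xs) (flatten-++ d e)

flatten-mapD : ∀ f d → flatten (mapD f d) ≡ map f (flatten d)
flatten-mapD f [] = ≡.refl
flatten-mapD f ((a , b) ∷ d) = cong (λ xs → f a ∷ f b ∷ xs) (flatten-mapD f d)

pairUp-map : ∀ f xs → pairUp (map f xs) ≡ mapD f (pairUp xs)
pairUp-map f [] = ≡.refl
pairUp-map f (x ∷ []) = ≡.refl
pairUp-map f (x ∷ y ∷ xs) = cong (_ ∷_) (pairUp-map f xs)

pairUp-flatten : ∀ d → pairUp (flatten d) ≡ d
pairUp-flatten [] = ≡.refl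
pairUp-flatten (p ∷ d) = cong (p ∷_) (pairUp-flatten d)

infix 4 _∈ᴰ_ _#_

_∈ᴰ_ : ℕ → Diagram → Set
z ∈ᴰ d = z ∈ flatten d

_#_ : Diagram → Diagram → Set
d # e = Disjoint (flatten d) (flatten e)

∈ᴰ-++⁺ˡ : ∀ {z} d {e} → z ∈ᴰ d → z ∈ᴰ d ++ e
∈ᴰ-++⁺ˡ {z} d {e} z∈ = subst (z ∈_) (≡.sym (flatten-++ d e)) (∈-++⁺ˡ z∈)

∈ᴰ-++⁺ʳ : ∀ {z} d {e} → z ∈ᴰ e → z ∈ᴰ d ++ e
∈ᴰ-++⁺ʳ {z} d {e} z∈ = subst (z ∈_) (≡.sym (flatten-++ d e)) (∈-++⁺ʳ (flatten d) z∈)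

∈ᴰ-++⁻ : ∀ {z} d {e} → z ∈ᴰ d ++ e → z ∈ᴰ d ⊎ z ∈ᴰ e
∈ᴰ-++⁻ {z} d {e} z∈ = ∈-++⁻ (flatten d) (subst (z ∈_) (flatten-++ d e) z∈)

∈ᴰ-mapD⁻ : ∀ {z} f d → z ∈ᴰ mapD f d → ∃ λ y → y ∈ᴰ d × z ≡ f y
∈ᴰ-mapD⁻ {z} f d z∈ = ∈-map⁻ f (subst (z ∈_) (flatten-mapD f d) z∈)

mapD-cong-∈ : ∀ {f g} d → (∀ {z} → z ∈ᴰ d → f z ≡ g z) → mapD f d ≡ mapD g d
mapD-cong-∈ [] f≗g = ≡.refl
mapD-cong-∈ (_ ∷ d) f≗g =
  cong₂ _∷_ (cong₂ _,_ (f≗g (here ≡.refl)) (f≗g (there (here ≡.refl)))) (mapD-cong-∈ d (λ z∈ → f≗g (there (there z∈))))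

mapD-id-∈ : ∀ {f} d → mapD f d ≡ d → ∀ {z} → z ∈ᴰ d → f z ≡ z
mapD-id-∈ {f} d eq = go (flatten d) (≡.trans (≡.sym (flatten-mapD f d)) (cong flatten eq))
  where
  go : ∀ xs → map f xs ≡ xs → ∀ {z} → z ∈ xs → f z ≡ z
  go (x ∷ xs) eq (here ≡.refl) = List.∷-injectiveˡ eq
  go (x ∷ xs) eq (there z∈) = go xs (List.∷-injectiveʳ eq) z∈

from∘to : ∀ {d e} (r : d ~ e) {z} → z ∈ᴰ d → from r (to r z) ≡ z
from∘to {d} (relabelling f g ≡.refl q) = mapD-id-∈ d (≡.trans (≡.sym (mapD-∘ g f d)) q)

to-injective : ∀ {d e} (r : d ~ e) {y z} → y ∈ᴰ d → z ∈ᴰ d → to r y ≡ to r z → y ≡ z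
to-injective r y∈ z∈ eq = ≡.trans (≡.sym (from∘to r y∈)) (≡.trans (cong (from r) eq) (from∘to r z∈))

mapD-injective⇒~ : ∀ f g d → (∀ {z} → z ∈ᴰ d → g (f z) ≡ z) → d ~ mapD f d
mapD-injective⇒~ f g d inv =
  relabelling f g ≡.refl (≡.trans (mapD-∘ g f d) (≡.trans (mapD-cong-∈ d inv) (mapD-id d)))

-- Normal forms

lookupA-∷-≡ : ∀ as x n → lookupA ((x , n) ∷ as) x ≡ just n
lookupA-∷-≡ as x n rewrite dec-true (x ℕ.≟ x) ≡.refl = ≡.refl

lookupA-∷-≢ : ∀ as {x y} n → y ≢ x → lookupA ((x , n) ∷ as) y ≡ lookupA as y
lookupA-∷-≢ as {x} {y} n y≢x rewrite dec-false (y ℕ.≟ x) y≢x = ≡.refl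

-- `relabel` inspects labels only through equality tests, so it cannot see an `f` that is injective
-- on the labels in play. `L` collects these once and stays fixed while `xs` is consumed.
relabel-map : ∀ L f → (∀ {x y} → x ∈ L → y ∈ L → f x ≡ f y → x ≡ y) →
  ∀ as bs n xs → (∀ {z} → z ∈ xs → z ∈ L) → (∀ {z} → z ∈ L → lookupA as (f z) ≡ lookupA bs z) →
  relabel as n (map f xs) ≡ relabel bs n xs
relabel-map L f inj as bs n [] xs⊆L agree = ≡.refl
relabel-map L f inj as bs n (x ∷ xs) xs⊆L agree with lookupA as (f x) | lookupA bs x | agree (xs⊆L (here ≡.refl))
... | just v  | .(just v) | ≡.refl = cong (v ∷_) (relabel-map L f inj as bs n xs (xs⊆L ∘ there) agree)
... | nothing | .nothing  | ≡.refl = cong (n ∷_) (relabel-map L f inj _ _ (suc n) xs (xs⊆L ∘ there) agree′)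
  where
  agree′ : ∀ {z} → z ∈ L → lookupA ((f x , n) ∷ as) (f z) ≡ lookupA ((x , n) ∷ bs) z
  agree′ {z} z∈ with z ℕ.≟ x
  ... | yes ≡.refl = ≡.trans (lookupA-∷-≡ as (f x) n) (≡.sym (lookupA-∷-≡ bs x n))
  ... | no z≢x = ≡.trans (lookupA-∷-≢ as n (z≢x ∘ inj z∈ (xs⊆L (here ≡.refl)))) (≡.trans (agree z∈) (≡.sym (lookupA-∷-≢ bs n z≢x)))

norm-cong : ∀ {d e} → d ~ e → norm d ≡ norm e
norm-cong {d} {e} r@(relabelling f g ≡.refl q) = cong pairUp (≡.sym (≡.trans (cong (relabel [] 0) (flatten-mapD f d))
  (relabel-map (flatten d) f (to-injective r) [] [] 0 (flatten d) id (λ _ → ≡.refl))))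

relabel-just : ∀ as n x xs {v} → lookupA as x ≡ just v → relabel as n (x ∷ xs) ≡ v ∷ relabel as n xs
relabel-just as n x xs eq with lookupA as x | eq
... | just v | ≡.refl = ≡.refl

relabel-nothing : ∀ as n x xs → lookupA as x ≡ nothing → relabel as n (x ∷ xs) ≡ n ∷ relabel ((x , n) ∷ as) (suc n) xs
relabel-nothing as n x xs eq with lookupA as x | eq
... | nothing | ≡.refl = ≡.refl

-- Values of the association list stay below the counter n, so that n is fresh and the list remains invertible.
record Invertible (as : List (ℕ × ℕ)) (n : ℕ) : Set where
  field
    key     : ℕ → ℕ
    key-≡   : ∀ {x v} → lookupA as x ≡ just v → key v ≡ x
    value-< : ∀ {x v} → lookupA as x ≡ just v → v < n

open Invertible

invertible-[] : Invertible [] 0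
invertible-[] = record { key = id ; key-≡ = λ () ; value-< = λ () }

invertible-∷ : ∀ {as n} x → Invertible as n → Invertible ((x , n) ∷ as) (suc n)
invertible-∷ {as} {n} x inv = record { key = key′ ; key-≡ = key′-≡ ; value-< = value′-< }
  where
  key′ : ℕ → ℕ
  key′ v = if does (v ℕ.≟ n) then x else key inv v
  key′-≡ : ∀ {y v} → lookupA ((x , n) ∷ as) y ≡ just v → key′ v ≡ y
  key′-≡ {y} {v} eq with y ℕ.≟ x
  ... | yes ≡.refl with ≡.refl ← ≡.trans (≡.sym (lookupA-∷-≡ as y n)) eq rewrite dec-true (n ℕ.≟ n) ≡.refl = ≡.refl
  ... | no y≢x with eq′ ← ≡.trans (≡.sym (lookupA-∷-≢ as n y≢x)) eq
    rewrite dec-false (v ℕ.≟ n) (ℕ.<⇒≢ (value-< inv eq′)) = key-≡ inv eq′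
  value′-< : ∀ {y v} → lookupA ((x , n) ∷ as) y ≡ just v → v < suc n
  value′-< {y} {v} eq with y ℕ.≟ x
  ... | yes ≡.refl with ≡.refl ← ≡.trans (≡.sym (lookupA-∷-≡ as y n)) eq = ℕ.≤-refl
  ... | no y≢x = ℕ.m<n⇒m<1+n (value-< inv (≡.trans (≡.sym (lookupA-∷-≢ as n y≢x)) eq))

lookup∷-stable : ∀ as x n → lookupA as x ≡ nothing → ∀ {y v} → lookupA as y ≡ just v → lookupA ((x , n) ∷ as) y ≡ just v
lookup∷-stable as x n x∉ {y} eq with y ℕ.≟ x
... | yes ≡.refl with () ← ≡.trans (≡.sym x∉) eq
... | no y≢x = ≡.trans (lookupA-∷-≢ as n y≢x) eq

-- `relabel` assigns values while its association list grows; `value` is the single function this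
-- amounts to in the end. Keys of `as` are included in `unvalue-≡` because a label just met passes
-- from `xs` into the list.
record Relabelled (as : List (ℕ × ℕ)) (n : ℕ) (xs : List ℕ) : Set where
  field
    value   : ℕ → ℕ
    unvalue : ℕ → ℕ
    extends : ∀ {x v} → lookupA as x ≡ just v → value x ≡ v
    relabel-≡   : relabel as n xs ≡ map value xs
    unvalue-≡ : ∀ {x} → x ∈ xs ⊎ (∃ λ v → lookupA as x ≡ just v) → unvalue (value x) ≡ x

open Relabelled

relabelled : ∀ as n xs → Invertible as n → Relabelled as n xs
relabelled as n [] inv = record
  -- With no labels left to read, only the keys of `as` are constrained, so the default `0` is
  -- arbitrary.
  { value = λ x → fromMaybe 0 (lookupA as x) ; unvalue = key inv
  ; extends = λ eq → cong (fromMaybe 0) eq ; relabel-≡ = ≡.refl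
  ; unvalue-≡ = λ { (inj₂ (v , eq)) → ≡.trans (cong (key inv ∘ fromMaybe 0) eq) (key-≡ inv eq) } }
relabelled as n (x ∷ xs) inv with lookupA as x in eq
... | just v = record
  { value = value r ; unvalue = unvalue r ; extends = extends r
  ; relabel-≡ = ≡.trans (relabel-just as n x xs eq) (cong₂ _∷_ (≡.sym (extends r eq)) (relabel-≡ r))
  ; unvalue-≡ = λ { (inj₁ (here ≡.refl)) → unvalue-≡ r (inj₂ (v , eq))
                  ; (inj₁ (there y∈)) → unvalue-≡ r (inj₁ y∈)
                  ; (inj₂ p) → unvalue-≡ r (inj₂ p) } }
  where r = relabelled as n xs inv
... | nothing = record
  { value = value r ; unvalue = unvalue r ; extends = extends r ∘ lookup∷-stable as x n eq
  ; relabel-≡ = ≡.trans (relabel-nothing as n x xs eq) (cong₂ _∷_ (≡.sym (extends r (lookupA-∷-≡ as x n))) (relabel-≡ r))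
  ; unvalue-≡ = λ { (inj₁ (here ≡.refl)) → unvalue-≡ r (inj₂ (n , lookupA-∷-≡ as x n))
                  ; (inj₁ (there y∈)) → unvalue-≡ r (inj₁ y∈)
                  ; (inj₂ (v , p)) → unvalue-≡ r (inj₂ (v , lookup∷-stable as x n eq p)) } }
  where r = relabelled ((x , n) ∷ as) (suc n) xs (invertible-∷ x inv)

~-norm : ∀ d → d ~ norm d
~-norm d = subst (d ~_) (≡.sym norm-≡) (mapD-injective⇒~ (value r) (unvalue r) d (unvalue-≡ r ∘ inj₁))
  where
  r = relabelled [] 0 (flatten d) invertible-[]
  norm-≡ : norm d ≡ mapD (value r) d
  norm-≡ = ≡.trans (cong pairUp (relabel-≡ r)) (≡.trans (pairUp-map (value r) (flatten d)) (cong (mapD (value r)) (pairUp-flatten d)))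

norm-idem : ∀ d → norm (norm d) ≡ norm d
norm-idem d = ≡.sym (norm-cong (~-norm d))

norm-≡⇒~ : ∀ {d e} → norm d ≡ norm e → d ~ e
norm-≡⇒~ {d} {e} eq = ~-trans (~-norm d) (~-trans (≡⇒~ eq) (~-sym (~-norm e)))

≈D-true : ∀ {d e} → d ~ e → (d ≈D e) ≡ true
≈D-true {d} {e} r = dec-true (norm d ≟D norm e) (norm-cong r)

≈D⇒~ : ∀ d e → (d ≈D e) ≡ true → d ~ e
≈D⇒~ d e eq with norm d ≟D norm e
... | yes p = norm-≡⇒~ p

~-length : ∀ {d e} → d ~ e → length d ≡ length e
~-length {d} (relabelling f g ≡.refl q) = ≡.sym (List.length-map _ d)

-- A relabelling acts column by column, so it respects the cut; it is injective on the labels of the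
-- whole concatenation, so it keeps disjoint pieces disjoint.
~-++⁻ : ∀ p {q e} → p ++ q ~ e → ∃ λ p′ → ∃ λ q′ → e ≡ p′ ++ q′ × p ~ p′ × q ~ q′ × (p # q → p′ # q′)
~-++⁻ p {q} r@(relabelling f g ≡.refl eq) = mapD f p , mapD f q , mapD-++ f p q ,
  mapD-injective⇒~ f g p (from∘to r ∘ ∈ᴰ-++⁺ˡ p) ,
  mapD-injective⇒~ f g q (from∘to r ∘ ∈ᴰ-++⁺ʳ p) ,
  λ p#q (z∈ , z∈′) → case (∈ᴰ-mapD⁻ f p z∈) (∈ᴰ-mapD⁻ f q z∈′) p#q
  where
  case : ∀ {z} → (∃ λ y → y ∈ᴰ p × z ≡ f y) → (∃ λ y → y ∈ᴰ q × z ≡ f y) → ¬ p # q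
  case (y , y∈ , ≡.refl) (y′ , y′∈ , e) p#q with ≡.refl ← to-injective r (∈ᴰ-++⁺ˡ p y∈) (∈ᴰ-++⁺ʳ p y′∈) e = p#q (y∈ , y′∈)

-- Gluing relabellings

piecewise : Diagram → (ℕ → ℕ) → (ℕ → ℕ) → ℕ → ℕ
piecewise a f g z = if does (z ∈? flatten a) then f z else g z

piecewise-∈ : ∀ a f g {z} → z ∈ᴰ a → piecewise a f g z ≡ f z
piecewise-∈ a f g {z} z∈ rewrite dec-true (z ∈? flatten a) z∈ = ≡.refl

mapD-piecewise : ∀ a b f g → (∀ {z} → z ∈ᴰ a → z ∈ᴰ b → f z ≡ g z) →
  mapD (piecewise a f g) (a ++ b) ≡ mapD f a ++ mapD g b
mapD-piecewise a b f g agree = ≡.trans (mapD-++ (piecewise a f g) a b)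
  (cong₂ _++_ (mapD-cong-∈ a (piecewise-∈ a f g)) (mapD-cong-∈ b on-b))
  where
  on-b : ∀ {z} → z ∈ᴰ b → piecewise a f g z ≡ g z
  on-b {z} z∈b with z ∈? flatten a
  ... | yes z∈a = agree z∈a z∈b
  ... | no _ = ≡.refl

-- Labels occurring on both sides are the only obstruction to combining two relabellings into one.
-- For `⊗D` there are none, for `•D` exactly one.
glue : ∀ {a a′ b b′} (r : a ~ a′) (s : b ~ b′) →
  (∀ {z} → z ∈ᴰ a → z ∈ᴰ b → to r z ≡ to s z) →
  (∀ {z} → z ∈ᴰ a′ → z ∈ᴰ b′ → from r z ≡ from s z) →
  a ++ b ~ a′ ++ b′
glue {a} {a′} {b} {b′} r s p q = relabelling (piecewise a (to r) (to s)) (piecewise a′ (from r) (from s))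
  (≡.trans (mapD-piecewise a b _ _ p) (cong₂ _++_ (to-≡ r) (to-≡ s)))
  (≡.trans (mapD-piecewise a′ b′ _ _ q) (cong₂ _++_ (from-≡ r) (from-≡ s)))

#-glue : ∀ {a a′ b b′} → a ~ a′ → b ~ b′ → a # b → a′ # b′ → a ++ b ~ a′ ++ b′
#-glue r s a#b a′#b′ = glue r s (λ u v → ⊥-elim (a#b (u , v))) (λ u v → ⊥-elim (a′#b′ (u , v)))

-- The product `⊗D`

shift-≡ : ∀ o d → shift o d ≡ mapD (o +ℕ_) d
shift-≡ o [] = ≡.refl
shift-≡ o (_ ∷ d) = cong (_ ∷_) (shift-≡ o d)

replace : ℕ → ℕ → ℕ → ℕ
replace b a z = if z ≡ᵇ b then a else z

rename-≡ : ∀ b a d → rename b a d ≡ mapD (replace b a) d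
rename-≡ b a [] = ≡.refl
rename-≡ b a (_ ∷ d) = cong (_ ∷_) (rename-≡ b a d)

replace-≡ : ∀ b a → replace b a b ≡ a
replace-≡ b a rewrite dec-true (b ℕ.≟ b) ≡.refl = ≡.refl

replace-≢ : ∀ {b z} a → z ≢ b → replace b a z ≡ z
replace-≢ {b} {z} a z≢b rewrite dec-false (z ℕ.≟ b) z≢b = ≡.refl

≤-maxLabel : ∀ d {z} → z ∈ᴰ d → z < suc (maxLabel d)
≤-maxLabel d = s≤s ∘ go (flatten d)
  where
  go : ∀ xs {z} → z ∈ xs → z ≤ foldr _⊔_ 0 xs
  go (x ∷ xs) (here ≡.refl) = ℕ.m≤m⊔n x _
  go (x ∷ xs) (there z∈) = ℕ.≤-trans (go xs z∈) (ℕ.m≤n⊔m x _)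

shift-~ : ∀ o d → d ~ shift o d
shift-~ o d = subst (d ~_) (≡.sym (shift-≡ o d)) (mapD-injective⇒~ (o +ℕ_) (_∸ o) d (λ {z} _ → ℕ.m+n∸m≡n o z))

shift-# : ∀ d e → d # shift (suc (maxLabel d)) e
shift-# d e {z} (z∈d , z∈e) with ∈ᴰ-mapD⁻ _ e (subst (z ∈ᴰ_) (shift-≡ (suc (maxLabel d)) e) z∈e)
... | y , _ , ≡.refl = ℕ.m+n≮m _ y (≤-maxLabel d z∈d)

-- The offset in `⊗D` is one way among many of making labels disjoint: by gluing, any disjoint
-- representatives give the same normal form. Identities about `⊗D` thereby reduce to identities
-- about `++`.
⊗-# : ∀ {d d′ e e′} → d ~ d′ → e ~ e′ → d′ # e′ → d ⊗D e ≡ norm (d′ ++ e′)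
⊗-# {d} {e = e} r s d′#e′ = norm-cong (#-glue r (~-trans (~-sym (shift-~ _ e)) s) (shift-# d e) d′#e′)

⊗-norm : ∀ d e → norm (d ⊗D e) ≡ d ⊗D e
⊗-norm d e = norm-idem (d ++ shift (suc (maxLabel d)) e)

⊗-cong : ∀ {d d′ e e′} → d ~ d′ → e ~ e′ → d ⊗D e ≡ d′ ⊗D e′
⊗-cong {d′ = d′} {e′ = e′} r s = ⊗-# r (~-trans s (shift-~ _ e′)) (shift-# d′ e′)

⊗-identityˡ : ∀ d → [] ⊗D d ≡ norm d
⊗-identityˡ d = ⊗-# {[]} {[]} {d} {d} ~-refl ~-refl (λ ())

⊗-identityʳ : ∀ d → d ⊗D [] ≡ norm d
⊗-identityʳ d = cong norm (List.++-identityʳ d)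

⊗-assoc : ∀ d e g → (d ⊗D e) ⊗D g ≡ d ⊗D (e ⊗D g)
⊗-assoc d e g = begin
  (d ⊗D e) ⊗D g          ≡⟨ ⊗-# (~-sym (~-norm (d ++ e′))) (shift-~ _ g) de′#g′ ⟩
  norm ((d ++ e′) ++ g′) ≡⟨ cong norm (List.++-assoc d e′ g′) ⟩
  norm (d ++ (e′ ++ g′)) ≡⟨ ⊗-# ~-refl eg~e′g′ d#e′g′ ⟨
  d ⊗D (e ⊗D g)          ∎
  where
  open ≡-Reasoning
  e′ = shift (suc (maxLabel d)) e
  -- Shifting past all of `d ++ e′` lets the same three lists represent both bracketings.
  g′ = shift (suc (maxLabel (d ++ e′))) g
  de′#g′ : (d ++ e′) # g′
  de′#g′ = shift-# (d ++ e′) g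
  eg~e′g′ : (e ⊗D g) ~ e′ ++ g′
  eg~e′g′ = ~-trans (≡⇒~ (⊗-# (shift-~ _ e) (shift-~ _ g) λ (u , v) → de′#g′ (∈ᴰ-++⁺ʳ d u , v))) (~-sym (~-norm _))
  d#e′g′ : d # (e′ ++ g′)
  d#e′g′ (u , v) with ∈ᴰ-++⁻ e′ v
  ... | inj₁ v∈e′ = shift-# d e (u , v∈e′)
  ... | inj₂ v∈g′ = de′#g′ (∈ᴰ-++⁺ˡ d u , v∈g′)

-- Linked representatives and the product `•D`

NonEmpty : Diagram → Set
NonEmpty d = Bool.T (nonempty d)

NonEmpty-resp : ∀ {d e} → d ~ e → NonEmpty d → NonEmpty e
NonEmpty-resp {_ ∷ _} (relabelling _ _ ≡.refl _) _ = tt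

firstB lastB : Diagram → ℕ
firstB []            = 0
firstB ((_ , b) ∷ _) = b
lastB []      = 0
lastB (c ∷ d) = lastBottom c d

firstB-mapD : ∀ f d → NonEmpty d → firstB (mapD f d) ≡ f (firstB d)
firstB-mapD f (_ ∷ _) _ = ≡.refl

lastB-mapD : ∀ f d → NonEmpty d → lastB (mapD f d) ≡ f (lastB d)
lastB-mapD f (_ ∷ []) _ = ≡.refl
lastB-mapD f (_ ∷ c ∷ d) _ = lastB-mapD f (c ∷ d) _

firstB-∈ : ∀ d → NonEmpty d → firstB d ∈ᴰ d
firstB-∈ (_ ∷ _) _ = there (here ≡.refl)

lastB-∈ : ∀ d → NonEmpty d → lastB d ∈ᴰ d
lastB-∈ (_ ∷ []) _ = there (here ≡.refl)
lastB-∈ (_ ∷ c ∷ d) _ = there (there (lastB-∈ (c ∷ d) _))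

firstB-++ : ∀ d e → NonEmpty d → firstB (d ++ e) ≡ firstB d
firstB-++ (_ ∷ _) e _ = ≡.refl

lastB-++ : ∀ d e → NonEmpty e → lastB (d ++ e) ≡ lastB e
lastB-++ [] e _ = ≡.refl
lastB-++ (_ ∷ []) (_ ∷ _) _ = ≡.refl
lastB-++ (_ ∷ c ∷ d) e ne = lastB-++ (c ∷ d) e ne

firstB-~ : ∀ {d e} (r : d ~ e) → NonEmpty d → to r (firstB d) ≡ firstB e
firstB-~ {d} (relabelling f _ ≡.refl _) ne = ≡.sym (firstB-mapD f d ne)

lastB-~ : ∀ {d e} (r : d ~ e) → NonEmpty d → to r (lastB d) ≡ lastB e
lastB-~ {d} (relabelling f _ ≡.refl _) ne = ≡.sym (lastB-mapD f d ne)

-- Representatives fit for `•D`: the two lower points to be merged already carry the same label and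
-- nothing else is shared, so `d ++ e` itself represents the product.
record Linked (d e : Diagram) : Set where
  field
    meet : lastB d ≡ firstB e
    only : ∀ {z} → z ∈ᴰ d → z ∈ᴰ e → z ≡ lastB d

open Linked

-- The shared label is `lastB a`, and its position fixes its image: `lastB a′` under `r` and, as it
-- is also `firstB b`, `firstB b′` under `s`. These agree because `a′` and `b′` are linked.
linked-to : ∀ {a a′ b b′} (r : a ~ a′) (s : b ~ b′) → NonEmpty a → NonEmpty b → Linked a b → Linked a′ b′ →
  ∀ {z} → z ∈ᴰ a → z ∈ᴰ b → to r z ≡ to s z
linked-to {a} {a′} {b} {b′} r s nea neb l l′ z∈a z∈b with ≡.refl ← only l z∈a z∈b = begin
  to r (lastB a)  ≡⟨ lastB-~ r nea ⟩
  lastB a′        ≡⟨ meet l′ ⟩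
  firstB b′       ≡⟨ firstB-~ s neb ⟨
  to s (firstB b) ≡⟨ cong (to s) (meet l) ⟨
  to s (lastB a)  ∎
  where open ≡-Reasoning

linked-glue : ∀ {a a′ b b′} → a ~ a′ → b ~ b′ → NonEmpty a → NonEmpty b → Linked a b → Linked a′ b′ → a ++ b ~ a′ ++ b′
linked-glue r s nea neb l l′ = glue r s (linked-to r s nea neb l l′)
  (linked-to (~-sym r) (~-sym s) (NonEmpty-resp r nea) (NonEmpty-resp s neb) l′ l)

-- The renaming in `•D` removes the single label `o +ℕ b`, which exceeds every label of `d`. Hence
-- `d` stays as it is, and shift and renaming together are one injective relabelling `f` of `e`.
•-linking : ∀ d e → NonEmpty d → NonEmpty e → ∃ λ e′ → e ~ e′ × Linked d e′ × d •D e ≡ norm (d ++ e′)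
•-linking d@(c ∷ π) e@((t , b) ∷ ρ) _ _ = mapD f e , mapD-injective⇒~ f g e (λ {z} _ → g∘f z) ,
  record { meet = ≡.sym (replace-≡ (o +ℕ b) a) ; only = only′ } , cong norm merged
  where
  o = suc (maxLabel d)
  a = lastBottom c π
  a<o : a < o
  a<o = ≤-maxLabel d (lastB-∈ d tt)
  f g : ℕ → ℕ
  f z = replace (o +ℕ b) a (o +ℕ z)
  -- The merged label `a` lies below `o` and all other values of `f` do not, so `g` can tell them
  -- apart.
  g z = if z ≡ᵇ a then b else z ∸ o
  g∘f : ∀ z → g (f z) ≡ z
  g∘f z with z ℕ.≟ b
  ... | yes ≡.refl rewrite replace-≡ (o +ℕ b) a | dec-true (a ℕ.≟ a) ≡.refl = ≡.refl
  ... | no z≢b rewrite replace-≢ {o +ℕ b} {o +ℕ z} a (z≢b ∘ ℕ.+-cancelˡ-≡ o z b)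
    | dec-false (o +ℕ z ℕ.≟ a) (λ eq → ℕ.m+n≮m o z (subst (_< o) (≡.sym eq) a<o)) = ℕ.m+n∸m≡n o z
  only′ : ∀ {z} → z ∈ᴰ d → z ∈ᴰ mapD f e → z ≡ a
  only′ z∈d z∈e with ∈ᴰ-mapD⁻ f e z∈e
  ... | y , _ , ≡.refl with y ℕ.≟ b
  ... | yes ≡.refl = replace-≡ (o +ℕ b) a
  ... | no y≢b with eq ← replace-≢ {o +ℕ b} {o +ℕ y} a (y≢b ∘ ℕ.+-cancelˡ-≡ o y b) =
    ⊥-elim (ℕ.m+n≮m o y (subst (_< o) eq (≤-maxLabel d z∈d)))
  unchanged : ∀ {z} → z ∈ᴰ d → replace (o +ℕ b) a z ≡ z
  unchanged z∈d = replace-≢ a (λ { ≡.refl → ℕ.m+n≮m o b (≤-maxLabel d z∈d) })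
  open ≡-Reasoning
  merged : rename (o +ℕ b) a (d ++ shift o e) ≡ d ++ mapD f e
  merged = begin
    rename (o +ℕ b) a (d ++ shift o e)                                ≡⟨ rename-≡ (o +ℕ b) a (d ++ shift o e) ⟩
    mapD (replace (o +ℕ b) a) (d ++ shift o e)                        ≡⟨ mapD-++ _ d (shift o e) ⟩
    mapD (replace (o +ℕ b) a) d ++ mapD (replace (o +ℕ b) a) (shift o e)
      ≡⟨ cong₂ _++_ (≡.trans (mapD-cong-∈ d unchanged) (mapD-id d))
           (≡.trans (cong (mapD (replace (o +ℕ b) a)) (shift-≡ o e)) (mapD-∘ (replace (o +ℕ b) a) (o +ℕ_) e)) ⟩
    d ++ mapD f e ∎

•-linked : ∀ {d d′ e e′} → NonEmpty d → NonEmpty e → d ~ d′ → e ~ e′ → Linked d′ e′ → d •D e ≡ norm (d′ ++ e′)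
•-linked {d} {e = e} ned nee r s l with •-linking d e ned nee
... | e″ , s″ , l″ , eq = ≡.trans eq (norm-cong (linked-glue r (~-trans (~-sym s″) s) ned (NonEmpty-resp s″ nee) l″ l))

•-identityʳ : ∀ d → d •D [] ≡ norm d
•-identityʳ [] = ≡.refl
•-identityʳ (_ ∷ _) = ≡.refl

•-norm : ∀ d e → norm (d •D e) ≡ d •D e
•-norm [] e = norm-idem e
•-norm (c ∷ d) [] = norm-idem (c ∷ d)
•-norm d@(_ ∷ _) e@(_ ∷ _) with •-linking d e tt tt
... | e′ , _ , _ , eq = ≡.trans (cong norm eq) (≡.trans (norm-idem (d ++ e′)) (≡.sym eq))

•-cong : ∀ {d d′ e e′} → d ~ d′ → e ~ e′ → d •D e ≡ d′ •D e′
•-cong {[]} (relabelling _ _ ≡.refl _) s = norm-cong s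
•-cong {d@(_ ∷ _)} {d′} {[]} r (relabelling _ _ ≡.refl _) = ≡.trans (norm-cong r) (≡.sym (•-identityʳ d′))
•-cong {d@(_ ∷ _)} {d′} {e@(_ ∷ _)} {e′} r s with •-linking d′ e′ (NonEmpty-resp r tt) (NonEmpty-resp s tt)
... | e″ , s′ , l , eq = ≡.trans (•-linked tt tt r (~-trans s s′) l) (≡.sym eq)

•-congˡ : ∀ d {e e′} → e ~ e′ → d •D e ≡ d •D e′
•-congˡ d = •-cong {d} ~-refl

•-congʳ : ∀ {d d′} e → d ~ d′ → d •D e ≡ d′ •D e
•-congʳ e r = •-cong {e = e} r ~-refl

NonEmpty-• : ∀ d e → NonEmpty d → NonEmpty (d •D e)
NonEmpty-• d [] ne = subst NonEmpty (≡.sym (•-identityʳ d)) (NonEmpty-resp (~-norm d) ne)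
NonEmpty-• d@(_ ∷ _) e@(_ ∷ _) _ with •-linking d e tt tt
... | e′ , _ , _ , eq = subst NonEmpty (≡.sym eq) (NonEmpty-resp (~-norm (d ++ e′)) tt)

-- A label common to `d` and `g` is already the one where `d` meets `e`; hence it occurs in `e`, and
-- so must be the one where `e` meets `g`.
linked-++ : ∀ {d e g} → NonEmpty e → Linked d (e ++ g) → Linked e g → Linked (d ++ e) g
linked-++ {d} {e} {g} ne l l′ = record
  { meet = ≡.trans (lastB-++ d e ne) (meet l′)
  ; only = λ z∈de z∈g → ≡.trans (only′ (∈ᴰ-++⁻ d z∈de) z∈g) (≡.sym (lastB-++ d e ne)) }
  where
  only′ : ∀ {z} → z ∈ᴰ d ⊎ z ∈ᴰ e → z ∈ᴰ g → z ≡ lastB e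
  only′ (inj₂ z∈e) z∈g = only l′ z∈e z∈g
  only′ (inj₁ z∈d) z∈g = only l′ (subst (_∈ᴰ e) (≡.sym z≡) (firstB-∈ e ne)) z∈g
    where z≡ = ≡.trans (only l z∈d (∈ᴰ-++⁺ʳ e z∈g)) (≡.trans (meet l) (firstB-++ e g ne))

-- For nonempty factors, `g` is linked to `e` first, and then `e ++ g₁` is relabelled as a whole so
-- as to be linked to `d`. The resulting `d`, `e₂`, `g₂` represent both bracketings, and
-- associativity is that of `++`.
•-assoc : ∀ d e g → (d •D e) •D g ≡ d •D (e •D g)
•-assoc [] e g = ≡.trans (•-congʳ g (~-sym (~-norm e))) (≡.sym (•-norm e g))
•-assoc d@(_ ∷ _) [] g = •-cong {norm d} {d} {g} (~-sym (~-norm d)) (~-norm g)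
•-assoc d@(_ ∷ _) e@(_ ∷ _) [] = ≡.trans (•-identityʳ (d •D e)) (≡.trans (•-norm d e) (•-congˡ d (~-norm e)))
•-assoc d@(_ ∷ _) e@(_ ∷ _) g@(_ ∷ _) with •-linking e g tt tt
... | g₁ , s₁ , l₁ , eq₁ with •-linking d (e ++ g₁) tt tt
... | y , r@(relabelling f h ≡.refl _) , l₂ , eq₂ = begin
  (d •D e) •D g          ≡⟨ •-linked (NonEmpty-• d e tt) tt de~ g~g₂ lde,g ⟩
  norm ((d ++ e₂) ++ g₂) ≡⟨ cong norm (List.++-assoc d e₂ g₂) ⟩
  norm (d ++ (e₂ ++ g₂)) ≡⟨ cong (λ x → norm (d ++ x)) (mapD-++ f e g₁) ⟨
  norm (d ++ mapD f (e ++ g₁)) ≡⟨ eq₂ ⟨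
  d •D (e ++ g₁)         ≡⟨ •-congˡ d (~-trans (~-norm (e ++ g₁)) (≡⇒~ (≡.sym eq₁))) ⟩
  d •D (e •D g)          ∎
  where
  open ≡-Reasoning
  e₂ = mapD f e
  g₂ = mapD f g₁
  inv : ∀ {z} → z ∈ᴰ e ++ g₁ → h (f z) ≡ z
  inv = from∘to r
  e~e₂ : e ~ e₂
  e~e₂ = mapD-injective⇒~ f h e (inv ∘ ∈ᴰ-++⁺ˡ e)
  g~g₂ : g ~ g₂
  g~g₂ = ~-trans s₁ (mapD-injective⇒~ f h g₁ (inv ∘ ∈ᴰ-++⁺ʳ e))
  ld,eg : Linked d (e₂ ++ g₂)
  ld,eg = subst (Linked d) (mapD-++ f e g₁) l₂
  only′ : ∀ {z} → (∃ λ y → y ∈ᴰ e × z ≡ f y) → (∃ λ y → y ∈ᴰ g₁ × z ≡ f y) → z ≡ lastB e₂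
  only′ (y , y∈e , ≡.refl) (y′ , y′∈g , fy≡fy′) with ≡.refl ← to-injective r (∈ᴰ-++⁺ˡ e y∈e) (∈ᴰ-++⁺ʳ e y′∈g) fy≡fy′ =
    ≡.trans (cong f (only l₁ y∈e y′∈g)) (≡.sym (lastB-mapD f e tt))
  le,g : Linked e₂ g₂
  le,g = record
    { meet = ≡.trans (lastB-mapD f e tt) (≡.trans (cong f (meet l₁)) (≡.sym (firstB-mapD f g₁ (NonEmpty-resp s₁ tt))))
    ; only = λ z∈e z∈g → only′ (∈ᴰ-mapD⁻ f e z∈e) (∈ᴰ-mapD⁻ f g₁ z∈g) }
  ld,e : Linked d e₂
  ld,e = record { meet = meet ld,eg ; only = λ z∈d z∈e → only ld,eg z∈d (∈ᴰ-++⁺ˡ e₂ z∈e) }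
  de~ : (d •D e) ~ d ++ e₂
  de~ = ~-trans (≡⇒~ (•-linked tt tt ~-refl e~e₂ ld,e)) (~-sym (~-norm _))
  lde,g : Linked (d ++ e₂) g₂
  lde,g = linked-++ tt ld,eg le,g

length-• : ∀ d e → length (d •D e) ≡ length d +ℕ length e
length-• [] e = ≡.sym (~-length (~-norm e))
length-• d@(_ ∷ _) [] = ≡.trans (≡.sym (~-length (~-norm d))) (≡.sym (ℕ.+-identityʳ _))
length-• d@(_ ∷ _) e@(_ ∷ _) with •-linking d e tt tt
... | e′ , s , _ , eq = ≡.trans (cong length eq) (≡.trans (≡.sym (~-length (~-norm (d ++ e′))))
  (≡.trans (List.length-++ d) (cong (length d +ℕ_) (≡.sym (~-length s)))))

-- Irreducibility

-- Irreducibility as the absence of cuts: a factorisation under `⊗D` is a place between two columns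
-- that no block crosses. In this form a cut is easily carried from a factor over to a product.
record Irr (d : Diagram) : Set where
  field
    inhabited : NonEmpty d
    no-split  : ∀ p q → d ≡ p ++ q → NonEmpty p → NonEmpty q → ¬ p # q

open Irr

Irr-resp : ∀ {d e} → d ~ e → Irr d → Irr e
Irr-resp r i = record { inhabited = NonEmpty-resp r (inhabited i) ; no-split = λ { p q ≡.refl nep neq p#q → split p nep neq p#q (~-++⁻ p (~-sym r)) } }
  where
  split : ∀ p {q} → NonEmpty p → NonEmpty q → p # q →
    (∃ λ p′ → ∃ λ q′ → _ ≡ p′ ++ q′ × p ~ p′ × q ~ q′ × (p # q → p′ # q′)) → ⊥
  split p nep neq p#q (p′ , q′ , eq , rp , rq , #′) = no-split i p′ q′ eq (NonEmpty-resp rp nep) (NonEmpty-resp rq neq) (#′ p#q)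

#-++ˡ : ∀ p {q e} → Linked (p ++ q) e → NonEmpty q → p # q → p # (q ++ e)
#-++ˡ p {q} l ne p#q (z∈p , z∈qe) with ∈ᴰ-++⁻ q z∈qe
... | inj₁ z∈q = p#q (z∈p , z∈q)
... | inj₂ z∈e = p#q (z∈p , subst (_∈ᴰ q) (≡.sym (≡.trans (only l (∈ᴰ-++⁺ˡ p z∈p) z∈e) (lastB-++ p q ne))) (lastB-∈ q ne))

#-++ʳ : ∀ {d} p {q} → Linked d (p ++ q) → NonEmpty p → p # q → (d ++ p) # q
#-++ʳ {d} p {q} l ne p#q (z∈dp , z∈q) with ∈ᴰ-++⁻ d z∈dp
... | inj₂ z∈p = p#q (z∈p , z∈q)
... | inj₁ z∈d = p#q (subst (_∈ᴰ p) (≡.sym (≡.trans (only l z∈d (∈ᴰ-++⁺ʳ p z∈q)) (≡.trans (meet l) (firstB-++ p q ne)))) (firstB-∈ p ne) , z∈q)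

#-sub : ∀ {p p′ q q′} → (∀ {z} → z ∈ᴰ p → z ∈ᴰ p′) → (∀ {z} → z ∈ᴰ q → z ∈ᴰ q′) → p′ # q′ → p # q
#-sub f g p′#q′ (u , v) = p′#q′ (f u , g v)

-- A cut of `d` into `p` and `q` would extend to a cut of `d •D e`: the second factor is attached at
-- the last lower point of `d`, which lies in `q`, so it joins the right piece without touching `p`.
Irr-•ˡ : ∀ d e → NonEmpty d → Irr (d •D e) → Irr d
Irr-•ˡ d [] _ i = Irr-resp (~-trans (≡⇒~ (•-identityʳ d)) (~-sym (~-norm d))) i
Irr-•ˡ d e@(_ ∷ _) ne i with •-linking d e ne tt
... | e′ , _ , l , eq = record { inhabited = ne ; no-split = split }
  where
  i′ : Irr (d ++ e′)
  i′ = Irr-resp (~-trans (≡⇒~ eq) (~-sym (~-norm (d ++ e′)))) i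
  split : ∀ p q → d ≡ p ++ q → NonEmpty p → NonEmpty q → ¬ p # q
  split p@(_ ∷ _) q@(_ ∷ _) ≡.refl _ _ p#q = no-split i′ p (q ++ e′) (List.++-assoc p q e′) tt tt (#-++ˡ p l tt p#q)

Irr-•ʳ : ∀ d e → NonEmpty e → Irr (d •D e) → Irr e
Irr-•ʳ [] e _ i = Irr-resp (~-sym (~-norm e)) i
Irr-•ʳ d@(_ ∷ _) e ne i with •-linking d e tt ne
... | e′ , s , l , eq = Irr-resp (~-sym s) (record { inhabited = NonEmpty-resp s ne ; no-split = split l i′ })
  where
  i′ : Irr (d ++ e′)
  i′ = Irr-resp (~-trans (≡⇒~ eq) (~-sym (~-norm (d ++ e′)))) i
  split : ∀ {e′} → Linked d e′ → Irr (d ++ e′) → ∀ p q → e′ ≡ p ++ q → NonEmpty p → NonEmpty q → ¬ p # q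
  split l i′ p@(_ ∷ _) q@(_ ∷ _) ≡.refl _ _ p#q = no-split i′ (d ++ p) q (≡.sym (List.++-assoc d p q)) tt tt (#-++ʳ p l tt p#q)

++-cancel-length : ∀ {A : Set} (p p′ : List A) {q q′} → length p ≡ length p′ → p ++ q ≡ p′ ++ q′ → p ≡ p′ × q ≡ q′
++-cancel-length [] [] _ eq = ≡.refl , eq
++-cancel-length (x ∷ p) (y ∷ p′) len eq with ++-cancel-length p p′ (ℕ.suc-injective len) (List.∷-injectiveʳ eq)
... | ≡.refl , eq′ = cong (_∷ p) (List.∷-injectiveˡ eq) , eq′

#⇒⊗~++ : ∀ {p q} → p # q → p ⊗D q ~ p ++ q
#⇒⊗~++ {p} {q} p#q = ~-trans (≡⇒~ (⊗-# {p} {p} {q} {q} ~-refl ~-refl p#q)) (~-sym (~-norm (p ++ q)))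

-- The shift inside `p ⊗D q` makes the two pieces disjoint. Carried along the relabelling, this
-- disjointness ends up at the cut of `p ++ q` after as many columns as `p` has, which is the cut
-- between `p` and `q`.
⊗~++⇒# : ∀ p q → p ⊗D q ~ p ++ q → p # q
⊗~++⇒# p q r with ~-++⁻ p (~-trans (~-norm (p ++ shift (suc (maxLabel p)) q)) r)
... | p′ , q′ , eq , rp , rq , #′ with ++-cancel-length p p′ (~-length rp) eq
... | ≡.refl , ≡.refl = #′ (shift-# p q)

irreducible-complete : ∀ {d} → Irr d → irreducible d ≡ true
irreducible-complete {d} i = cong₂ (λ a b → a ∧ not b) (T⇒true (inhabited i)) (¬T⇒false not-reducible)
  where
  T⇒true : ∀ {b} → Bool.T b → b ≡ true
  T⇒true {true} _ = ≡.refl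
  ¬T⇒false : ∀ {b} → ¬ Bool.T b → b ≡ false
  ¬T⇒false {false} _ = ≡.refl
  ¬T⇒false {true} ¬t = ⊥-elim (¬t tt)
  -- `reducible` cuts after `suc j` columns with `j` below `length d ∸ 1`, so neither piece of the
  -- cut is empty.
  <-pred : ∀ {j} n → j < n ∸ 1 → suc j < n
  <-pred (suc n) = s≤s
  NonEmpty-take : ∀ j d → suc j < length d → NonEmpty (take (suc j) d)
  NonEmpty-take j (_ ∷ _) _ = tt
  NonEmpty-drop : ∀ j d → j < length d → NonEmpty (drop j d)
  NonEmpty-drop zero (_ ∷ _) _ = tt
  NonEmpty-drop (suc j) (_ ∷ d) (s≤s j<) = NonEmpty-drop j d j<
  not-reducible : ¬ Bool.T (reducible d)
  not-reducible t with find (any⁻ (λ j → splitsAt (suc j) d) (upTo (length d ∸ 1)) t)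
  ... | j , j∈ , t′ = no-split i (take (suc j) d) (drop (suc j) d) (≡.sym (List.take++drop≡id (suc j) d))
    (NonEmpty-take j d j<) (NonEmpty-drop (suc j) d j<)
    (⊗~++⇒# _ _ (~-trans (≈D⇒~ _ d (T⇒true t′)) (≡⇒~ (≡.sym (List.take++drop≡id (suc j) d)))))
    where
    j< : suc j < length d
    j< = <-pred (length d) (∈-upTo⁻ j∈)

-- Factorisation

-- The condition scrutinised by `factorsAcc` at each column. For nonempty `q` it amounts to `p # q`.
splitTest : Diagram → Diagram → Bool
splitTest p q = nonempty q ∧ ((norm p ⊗D norm q) ≈D (p ++ q))

splitTest-true : ∀ p q → NonEmpty q → p # q → splitTest p q ≡ true
splitTest-true p q@(_ ∷ _) _ p#q = ≈D-true (~-trans (≡⇒~ (⊗-cong (~-sym (~-norm p)) (~-sym (~-norm q)))) (#⇒⊗~++ p#q))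

splitTest⇒# : ∀ p q → splitTest p q ≡ true → NonEmpty q × p # q
splitTest⇒# p q@(_ ∷ _) eq = tt , ⊗~++⇒# p q (~-trans (≡⇒~ (⊗-cong (~-norm p) (~-norm q))) (≈D⇒~ (norm p ⊗D norm q) (p ++ q) eq))

splitTest-false : ∀ p q → (NonEmpty q → ¬ p # q) → splitTest p q ≡ false
splitTest-false p q ¬# with splitTest p q in eq
... | false = ≡.refl
... | true with splitTest⇒# p q eq
... | ne , p#q = ⊥-elim (¬# ne p#q)

-- The third relabelling does not follow from the first two: which labels the pieces share is
-- visible only in the concatenation.
splitTest-cong : ∀ {p p′ q q′} → p ~ p′ → q ~ q′ → p ++ q ~ p′ ++ q′ → splitTest p q ≡ splitTest p′ q′
splitTest-cong {p} {p′} {q} {q′} r s u = begin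
  nonempty q ∧ test (norm p) (norm q) (norm (p ++ q))     ≡⟨ cong (_∧ test (norm p) (norm q) (norm (p ++ q))) (nonempty-~ s) ⟩
  nonempty q′ ∧ test (norm p) (norm q) (norm (p ++ q))    ≡⟨ cong (λ x → nonempty q′ ∧ test x (norm q) (norm (p ++ q))) (norm-cong r) ⟩
  nonempty q′ ∧ test (norm p′) (norm q) (norm (p ++ q))   ≡⟨ cong (λ x → nonempty q′ ∧ test (norm p′) x (norm (p ++ q))) (norm-cong s) ⟩
  nonempty q′ ∧ test (norm p′) (norm q′) (norm (p ++ q))  ≡⟨ cong (λ x → nonempty q′ ∧ test (norm p′) (norm q′) x) (norm-cong u) ⟩
  nonempty q′ ∧ test (norm p′) (norm q′) (norm (p′ ++ q′)) ∎
  where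
  open ≡-Reasoning
  test : Diagram → Diagram → Diagram → Bool
  test x y z = does (norm (x ⊗D y) ≟D z)
  nonempty-~ : ∀ {d e} → d ~ e → nonempty d ≡ nonempty e
  nonempty-~ {[]} (relabelling _ _ ≡.refl _) = ≡.refl
  nonempty-~ {_ ∷ _} (relabelling _ _ ≡.refl _) = ≡.refl

empty? : ∀ (d : Diagram) → d ≡ [] ⊎ NonEmpty d
empty? []      = inj₁ ≡.refl
empty? (_ ∷ _) = inj₂ tt

NonEmpty-++ : ∀ (d e : Diagram) → NonEmpty e → NonEmpty (d ++ e)
NonEmpty-++ []      e ne = ne
NonEmpty-++ (_ ∷ _) e _  = tt

factorsAcc-true : ∀ pre c rest → splitTest (pre ∷ʳ c) rest ≡ true →
  factorsAcc pre (c ∷ rest) ≡ norm (pre ∷ʳ c) ∷ factorsAcc [] rest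
factorsAcc-true [] c rest eq rewrite eq = ≡.refl
factorsAcc-true (_ ∷ _) c rest eq rewrite eq = ≡.refl

factorsAcc-false : ∀ pre c rest → splitTest (pre ∷ʳ c) rest ≡ false →
  factorsAcc pre (c ∷ rest) ≡ factorsAcc (pre ∷ʳ c) rest
factorsAcc-false [] c rest eq rewrite eq = ≡.refl
factorsAcc-false (_ ∷ _) c rest eq rewrite eq = ≡.refl

factorsAcc-[] : ∀ pre → NonEmpty pre → factorsAcc pre [] ≡ norm pre ∷ []
factorsAcc-[] (_ ∷ _) _ = ≡.refl

NonEmpty-∷ʳ : ∀ (pre : Diagram) {c} → NonEmpty (pre ∷ʳ c)
NonEmpty-∷ʳ [] = tt
NonEmpty-∷ʳ (_ ∷ _) = tt

factorsAcc-mapD : ∀ f g pre rest → (∀ {z} → z ∈ᴰ pre → g (f z) ≡ z) → (∀ {z} → z ∈ᴰ rest → g (f z) ≡ z) →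
  factorsAcc (mapD f pre) (mapD f rest) ≡ factorsAcc pre rest
factorsAcc-mapD f g [] [] _ _ = ≡.refl
factorsAcc-mapD f g pre@(_ ∷ _) [] inv _ = cong (_∷ []) (≡.sym (norm-cong (mapD-injective⇒~ f g pre inv)))
factorsAcc-mapD f g pre (c ∷ rest) inv inv′ = step (splitTest (pre ∷ʳ c) rest) ≡.refl
  where
  c′ = ×-map f f c
  pre≡ : mapD f pre ∷ʳ c′ ≡ mapD f (pre ∷ʳ c)
  pre≡ = ≡.sym (mapD-++ f pre (c ∷ []))
  inv-pre : ∀ {z} → z ∈ᴰ pre ∷ʳ c → g (f z) ≡ z
  inv-pre z∈ with ∈ᴰ-++⁻ pre z∈
  ... | inj₁ z∈pre = inv z∈pre
  ... | inj₂ (here ≡.refl) = inv′ (here ≡.refl)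
  ... | inj₂ (there (here ≡.refl)) = inv′ (there (here ≡.refl))
  inv-rest : ∀ {z} → z ∈ᴰ rest → g (f z) ≡ z
  inv-rest z∈ = inv′ (there (there z∈))
  pre~ : pre ∷ʳ c ~ mapD f pre ∷ʳ c′
  pre~ = subst (pre ∷ʳ c ~_) (≡.sym pre≡) (mapD-injective⇒~ f g (pre ∷ʳ c) inv-pre)
  test≡ : splitTest (pre ∷ʳ c) rest ≡ splitTest (mapD f pre ∷ʳ c′) (mapD f rest)
  test≡ = splitTest-cong pre~ (mapD-injective⇒~ f g rest inv-rest)
    (subst ((pre ∷ʳ c) ++ rest ~_) (≡.trans (mapD-++ f (pre ∷ʳ c) rest) (cong (_++ mapD f rest) (≡.sym pre≡)))
      (mapD-injective⇒~ f g ((pre ∷ʳ c) ++ rest) (λ z∈ → [ inv-pre , inv-rest ] (∈ᴰ-++⁻ (pre ∷ʳ c) z∈))))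
  step : ∀ b → splitTest (pre ∷ʳ c) rest ≡ b → factorsAcc (mapD f pre) (c′ ∷ mapD f rest) ≡ factorsAcc pre (c ∷ rest)
  step true eq = begin
    factorsAcc (mapD f pre) (c′ ∷ mapD f rest)         ≡⟨ factorsAcc-true (mapD f pre) c′ (mapD f rest) (≡.trans (≡.sym test≡) eq) ⟩
    norm (mapD f pre ∷ʳ c′) ∷ factorsAcc [] (mapD f rest)
      ≡⟨ cong₂ _∷_ (≡.sym (norm-cong pre~)) (factorsAcc-mapD f g [] rest (λ ()) inv-rest) ⟩
    norm (pre ∷ʳ c) ∷ factorsAcc [] rest               ≡⟨ factorsAcc-true pre c rest eq ⟨
    factorsAcc pre (c ∷ rest)                          ∎
    where open ≡-Reasoning
  step false eq = begin
    factorsAcc (mapD f pre) (c′ ∷ mapD f rest)         ≡⟨ factorsAcc-false (mapD f pre) c′ (mapD f rest) (≡.trans (≡.sym test≡) eq) ⟩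
    factorsAcc (mapD f pre ∷ʳ c′) (mapD f rest)        ≡⟨ cong (λ p → factorsAcc p (mapD f rest)) pre≡ ⟩
    factorsAcc (mapD f (pre ∷ʳ c)) (mapD f rest)       ≡⟨ factorsAcc-mapD f g (pre ∷ʳ c) rest inv-pre inv-rest ⟩
    factorsAcc (pre ∷ʳ c) rest                         ≡⟨ factorsAcc-false pre c rest eq ⟨
    factorsAcc pre (c ∷ rest)                          ∎
    where open ≡-Reasoning

factorsAcc-~ : ∀ {d e} → d ~ e → factorsAcc [] e ≡ factorsAcc [] d
factorsAcc-~ {d} r@(relabelling f g ≡.refl _) = factorsAcc-mapD f g [] d (λ ()) (from∘to r)

factors-~ : ∀ {d e} → d ~ e → factors d ≡ factors e
factors-~ r = cong (factorsAcc []) (norm-cong r)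

factors-≡ : ∀ d → factors d ≡ factorsAcc [] d
factors-≡ d = factorsAcc-~ (~-norm d)

-- This is where uniqueness of the factorisation comes from: `b` shares no label with what precedes
-- it, so a test made inside `a` has the same outcome whether or not `b` follows, and at the end of
-- `a` the cut before `b` is found.
factorsAcc-++ : ∀ pre a b → NonEmpty a → NonEmpty b → (pre ++ a) # b →
  factorsAcc pre (a ++ b) ≡ factorsAcc pre a ++ factorsAcc [] b
factorsAcc-++ pre (c ∷ a) b _ neb dis = go (empty? a) (splitTest (pre ∷ʳ c) a) ≡.refl
  where
  open ≡-Reasoning
  dis′ : ((pre ∷ʳ c) ++ a) # b
  dis′ = subst (_# b) (≡.sym (List.++-assoc pre (c ∷ []) a)) dis
  a#b : a # b
  a#b = #-sub (∈ᴰ-++⁺ʳ (pre ∷ʳ c)) id dis′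
  pre#b : (pre ∷ʳ c) # b
  pre#b = #-sub (∈ᴰ-++⁺ˡ (pre ∷ʳ c)) id dis′
  go : a ≡ [] ⊎ NonEmpty a → ∀ t → splitTest (pre ∷ʳ c) a ≡ t →
    factorsAcc pre (c ∷ (a ++ b)) ≡ factorsAcc pre (c ∷ a) ++ factorsAcc [] b
  go (inj₁ ≡.refl) _ _ = begin
    factorsAcc pre (c ∷ b)                      ≡⟨ factorsAcc-true pre c b (splitTest-true (pre ∷ʳ c) b neb pre#b) ⟩
    norm (pre ∷ʳ c) ∷ factorsAcc [] b           ≡⟨ cong (_++ factorsAcc [] b) (factorsAcc-[] (pre ∷ʳ c) (NonEmpty-∷ʳ pre)) ⟨
    factorsAcc (pre ∷ʳ c) [] ++ factorsAcc [] b ≡⟨ cong (_++ factorsAcc [] b) (factorsAcc-false pre c [] ≡.refl) ⟨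
    factorsAcc pre (c ∷ []) ++ factorsAcc [] b  ∎
  go (inj₂ nea) true eq = begin
    factorsAcc pre (c ∷ (a ++ b))
      ≡⟨ factorsAcc-true pre c (a ++ b) (splitTest-true (pre ∷ʳ c) (a ++ b) (NonEmpty-++ a b neb) pre#ab) ⟩
    norm (pre ∷ʳ c) ∷ factorsAcc [] (a ++ b)
      ≡⟨ cong (norm (pre ∷ʳ c) ∷_) (factorsAcc-++ [] a b nea neb a#b) ⟩
    (norm (pre ∷ʳ c) ∷ factorsAcc [] a) ++ factorsAcc [] b
      ≡⟨ cong (_++ factorsAcc [] b) (factorsAcc-true pre c a eq) ⟨
    factorsAcc pre (c ∷ a) ++ factorsAcc [] b ∎
    where
    pre#ab : (pre ∷ʳ c) # (a ++ b)
    pre#ab (u , v) with ∈ᴰ-++⁻ a v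
    ... | inj₁ v∈a = proj₂ (splitTest⇒# (pre ∷ʳ c) a eq) (u , v∈a)
    ... | inj₂ v∈b = pre#b (u , v∈b)
  go (inj₂ nea) false eq = begin
    factorsAcc pre (c ∷ (a ++ b))
      ≡⟨ factorsAcc-false pre c (a ++ b) (splitTest-false (pre ∷ʳ c) (a ++ b) not-disjoint) ⟩
    factorsAcc (pre ∷ʳ c) (a ++ b)
      ≡⟨ factorsAcc-++ (pre ∷ʳ c) a b nea neb dis′ ⟩
    factorsAcc (pre ∷ʳ c) a ++ factorsAcc [] b
      ≡⟨ cong (_++ factorsAcc [] b) (factorsAcc-false pre c a eq) ⟨
    factorsAcc pre (c ∷ a) ++ factorsAcc [] b ∎
    where
    not-disjoint : NonEmpty (a ++ b) → ¬ (pre ∷ʳ c) # (a ++ b)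
    not-disjoint _ pre#ab with () ← ≡.trans (≡.sym eq) (splitTest-true (pre ∷ʳ c) a nea (#-sub id (∈ᴰ-++⁺ˡ a) pre#ab))

factors-⊗ : ∀ d e → factors (d ⊗D e) ≡ factors d ++ factors e
factors-⊗ d e = go (empty? d) (empty? e)
  where
  open ≡-Reasoning
  e′ = shift (suc (maxLabel d)) e
  e~e′ : e ~ e′
  e~e′ = shift-~ _ e
  go : d ≡ [] ⊎ NonEmpty d → e ≡ [] ⊎ NonEmpty e → factors (d ⊗D e) ≡ factors d ++ factors e
  go (inj₁ ≡.refl) _ = factors-~ (~-trans (≡⇒~ (⊗-identityˡ e)) (~-sym (~-norm e)))
  go (inj₂ _) (inj₁ ≡.refl) =
    ≡.trans (factors-~ (~-trans (≡⇒~ (⊗-identityʳ d)) (~-sym (~-norm d)))) (≡.sym (List.++-identityʳ (factors d)))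
  go (inj₂ ned) (inj₂ nee) = begin
    factors (d ⊗D e)                    ≡⟨ cong (factorsAcc []) (⊗-norm d e) ⟩
    factorsAcc [] (norm (d ++ e′))      ≡⟨ factorsAcc-~ (~-norm (d ++ e′)) ⟩
    factorsAcc [] (d ++ e′)             ≡⟨ factorsAcc-++ [] d e′ ned (NonEmpty-resp e~e′ nee) (shift-# d e) ⟩
    factorsAcc [] d ++ factorsAcc [] e′ ≡⟨ cong₂ _++_ (≡.sym (factors-≡ d)) (≡.trans (factorsAcc-~ e~e′) (≡.sym (factors-≡ e))) ⟩
    factors d ++ factors e              ∎

factors-Irr : ∀ {d} → Irr d → factors d ≡ norm d ∷ []
factors-Irr {d} i = ≡.trans (factors-≡ d) (go [] d (inhabited i) i)
  where
  go : ∀ pre rest → NonEmpty rest → Irr (pre ++ rest) → factorsAcc pre rest ≡ norm (pre ++ rest) ∷ []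
  go pre (c ∷ rest) _ i with empty? rest
  ... | inj₁ ≡.refl = ≡.trans (factorsAcc-false pre c [] ≡.refl) (factorsAcc-[] (pre ∷ʳ c) (NonEmpty-∷ʳ pre))
  ... | inj₂ ne =
    ≡.trans (factorsAcc-false pre c rest (splitTest-false (pre ∷ʳ c) rest (no-split i (pre ∷ʳ c) rest (≡.sym assoc) (NonEmpty-∷ʳ pre))))
      (≡.trans (go (pre ∷ʳ c) rest ne (subst Irr (≡.sym assoc) i)) (cong (λ x → norm x ∷ []) assoc))
    where
    assoc : (pre ∷ʳ c) ++ rest ≡ pre ++ c ∷ rest
    assoc = List.++-assoc pre (c ∷ []) rest

-- Invariant of the greedy factorisation: no prefix of the columns read so far splits off.
Unsplit : Diagram → Diagram → Set
Unsplit pre rest = ∀ p q → pre ≡ p ++ q → NonEmpty p → NonEmpty (q ++ rest) → ¬ p # (q ++ rest)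

-- The last column of the nonempty `q` is `c`; handing it back to the remaining columns turns the
-- cut into one that `Unsplit` excludes.
unsplit-∷ʳ : ∀ {pre c rest} → Unsplit pre (c ∷ rest) →
  ∀ p q → pre ∷ʳ c ≡ p ++ q → NonEmpty p → NonEmpty q → ¬ p # (q ++ rest)
unsplit-∷ʳ {pre} {c} {rest} u p q eq nep neq p#q with initLast q
... | q′ ∷ʳ′ c′ with List.∷ʳ-injective pre (p ++ q′) (≡.trans eq (≡.sym (List.++-assoc p q′ (c′ ∷ []))))
... | ≡.refl , ≡.refl = u p q′ ≡.refl nep (ne q′) (subst (p #_) (List.++-assoc q′ (c ∷ []) rest) p#q)
  where
  ne : ∀ (q : Diagram) → NonEmpty (q ++ c ∷ rest)
  ne [] = tt
  ne (_ ∷ _) = tt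

-- Greediness gives irreducibility: a cut inside the prefix just split off would be a cut of all the
-- columns at an earlier place, which `Unsplit` excludes.
factorsAcc-All : ∀ pre rest → NonEmpty rest → Unsplit pre rest → All Irr (factorsAcc pre rest)
factorsAcc-All pre (c ∷ rest) _ u = step (splitTest (pre ∷ʳ c) rest) ≡.refl
  where
  first : (∀ {z} → z ∈ᴰ pre ∷ʳ c → ¬ z ∈ᴰ rest) → Irr (norm (pre ∷ʳ c))
  first dis = Irr-resp (~-norm (pre ∷ʳ c)) (record { inhabited = NonEmpty-∷ʳ pre ; no-split = λ p q eq nep neq p#q →
    unsplit-∷ʳ u p q eq nep neq (λ (v , w) → [ (λ w∈q → p#q (v , w∈q)) , dis (subst (_ ∈ᴰ_) (≡.sym eq) (∈ᴰ-++⁺ˡ p v)) ] (∈ᴰ-++⁻ q w)) })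
  step : ∀ t → splitTest (pre ∷ʳ c) rest ≡ t → All Irr (factorsAcc pre (c ∷ rest))
  step true eq with ne , dis ← splitTest⇒# (pre ∷ʳ c) rest eq =
    subst (All Irr) (≡.sym (factorsAcc-true pre c rest eq)) (first (λ v w → dis (v , w)) ∷ factorsAcc-All [] rest ne λ { [] [] _ () })
  step false eq = subst (All Irr) (≡.sym (factorsAcc-false pre c rest eq)) (tail (empty? rest))
    where
    tail : rest ≡ [] ⊎ NonEmpty rest → All Irr (factorsAcc (pre ∷ʳ c) rest)
    tail (inj₁ ≡.refl) = subst (All Irr) (≡.sym (factorsAcc-[] (pre ∷ʳ c) (NonEmpty-∷ʳ pre))) (first (λ _ ()) ∷ [])
    tail (inj₂ ne) = factorsAcc-All (pre ∷ʳ c) rest ne unsplit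
      where
      unsplit : Unsplit (pre ∷ʳ c) rest
      unsplit p q@(_ ∷ _) eq′ nep _ = unsplit-∷ʳ u p q eq′ nep tt
      -- The one new cut is the one right after `c`, and the failed test rules it out.
      unsplit p [] eq′ nep ne p#rest with ≡.refl ← ≡.trans (≡.sym (List.++-identityʳ p)) (≡.sym eq′)
        with () ← ≡.trans (≡.sym eq) (splitTest-true (pre ∷ʳ c) rest ne p#rest)

factors-All : ∀ d → All Irr (factors d)
factors-All d with empty? d
... | inj₁ ≡.refl = []
... | inj₂ ne   = subst (All Irr) (≡.sym (factors-≡ d)) (factorsAcc-All [] d ne λ { [] [] _ () })

-- Compositions

bump : List ℕ → List ℕ
bump []      = []
bump (h ∷ t) = suc h ∷ t

-- The positive sum excludes `c ≡ []`, where `bump` would act on `a` itself.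
bump-∷ʳ : ∀ c {n} a → sum c ≡ suc n → bump (c ∷ʳ a) ≡ bump c ∷ʳ a
bump-∷ʳ (h ∷ c) a _ = ≡.refl

All-concatMap⁺ : ∀ {a b p} {A : Set a} {B : Set b} {P : B → Set p} (g : A → List B) {xs} →
  All (All P ∘ g) xs → All P (concatMap g xs)
All-concatMap⁺ g = All.concat⁺ ∘ All.map⁺

compsS-sum : ∀ n → All (λ c → sum c ≡ suc n) (compsS n)
compsS-sum zero    = ≡.refl ∷ []
compsS-sum (suc n) = All-concatMap⁺ _ (All.map (λ {c} → bumped c) (compsS-sum n))
  where
  bumped : ∀ c → sum c ≡ suc n → All (λ c → sum c ≡ suc (suc n)) _
  bumped (h ∷ c) eq = cong suc eq ∷ cong suc eq ∷ []

comps-sum : ∀ n → All (λ c → sum c ≡ n) (comps n)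
comps-sum zero    = ≡.refl ∷ []
comps-sum (suc n) = compsS-sum n

-- Restricted growth strings

next : ℕ → ℕ → ℕ
next a m = if a ≡ᵇ m then suc m else m

next-≡ : ∀ m → next m m ≡ suc m
next-≡ m rewrite dec-true (m ℕ.≟ m) ≡.refl = ≡.refl

next-< : ∀ {a m} → a < m → next a m ≡ m
next-< {a} {m} a<m rewrite dec-false (a ℕ.≟ m) (ℕ.<⇒≢ a<m) = ≡.refl

-- The index counts the labels already in use: the next entry is one of them or the fresh label `m`.
data Growth : ℕ → List ℕ → Set where
  []  : ∀ {m} → Growth m []
  _∷_ : ∀ {m a xs} → a < suc m → Growth (next a m) xs → Growth m (a ∷ xs)

rgs-Growth : ∀ n m → All (λ xs → length xs ≡ n × Growth m xs) (rgs n m)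
rgs-Growth zero m = (≡.refl , []) ∷ []
rgs-Growth (suc n) m = All-concatMap⁺ _ (All.applyUpTo⁺₁ id (suc m) (λ {a} a<m →
  All.map⁺ (All.map (λ (len , g) → cong suc len , a<m ∷ g) (rgs-Growth n (next a m)))))

relabel-Growth : ∀ as n xs → Invertible as n → Growth n (relabel as n xs)
relabel-Growth as n [] inv = []
relabel-Growth as n (x ∷ xs) inv with lookupA as x in eq
... | just v = ℕ.m<n⇒m<1+n v<n ∷ subst (λ m → Growth m (relabel as n xs)) (≡.sym (next-< v<n)) (relabel-Growth as n xs inv)
  where v<n = Invertible.value-< inv eq
... | nothing = ℕ.≤-refl ∷ subst (λ m → Growth m (relabel ((x , n) ∷ as) (suc n) xs)) (≡.sym (next-≡ n))
  (relabel-Growth ((x , n) ∷ as) (suc n) xs (invertible-∷ x inv))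

relabel-length : ∀ as n xs → length (relabel as n xs) ≡ length xs
relabel-length as n [] = ≡.refl
relabel-length as n (x ∷ xs) with lookupA as x
... | just _  = cong suc (relabel-length as n xs)
... | nothing = cong suc (relabel-length _ (suc n) xs)

-- The state of `relabel` on a restricted growth string: each new label `m` is sent to the counter,
-- which is `m` as well, so the string is reproduced unchanged.
Diagonal : List (ℕ × ℕ) → ℕ → Set
Diagonal as m = (∀ {x} → x < m → lookupA as x ≡ just x) × (∀ {x} → m ≤ x → lookupA as x ≡ nothing)

diagonal-∷ : ∀ as {m} → Diagonal as m → Diagonal ((m , m) ∷ as) (suc m)
diagonal-∷ as {m} (old , new) = old′ , λ m<x → ≡.trans (lookupA-∷-≢ as m (ℕ.>⇒≢ m<x)) (new (ℕ.<⇒≤ m<x))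
  where
  old′ : ∀ {x} → x < suc m → lookupA ((m , m) ∷ as) x ≡ just x
  old′ {x} x<1+m with x ℕ.≟ m
  ... | yes ≡.refl = lookupA-∷-≡ as m m
  ... | no x≢m = ≡.trans (lookupA-∷-≢ as m x≢m) (old (ℕ.≤∧≢⇒< (s≤s⁻¹ x<1+m) x≢m))

relabel-id : ∀ as {m xs} → Diagonal as m → Growth m xs → relabel as m xs ≡ xs
relabel-id as diag [] = ≡.refl
relabel-id as {m} {a ∷ xs} diag@(old , new) (a<1+m ∷ g) with a ℕ.≟ m
... | yes ≡.refl = ≡.trans (relabel-nothing as m m xs (new ℕ.≤-refl))
  (cong (m ∷_) (relabel-id ((m , m) ∷ as) (diagonal-∷ as diag) (subst (λ n → Growth n xs) (next-≡ m) g)))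
... | no a≢m = ≡.trans (relabel-just as m a xs (old a<m)) (cong (a ∷_) (relabel-id as diag (subst (λ n → Growth n xs) (next-< a<m) g)))
  where a<m = ℕ.≤∧≢⇒< (s≤s⁻¹ a<1+m) a≢m

flatten-pairUp : ∀ k xs → length xs ≡ k +ℕ k → flatten (pairUp xs) ≡ xs
flatten-pairUp zero [] _ = ≡.refl
flatten-pairUp (suc k) (x ∷ []) eq with () ← ≡.trans (ℕ.suc-injective eq) (ℕ.+-suc k k)
flatten-pairUp (suc k) (x ∷ y ∷ xs) eq =
  cong (λ zs → x ∷ y ∷ zs) (flatten-pairUp k xs (ℕ.suc-injective (≡.trans (ℕ.suc-injective eq) (ℕ.+-suc k k))))

length-flatten : ∀ d → length (flatten d) ≡ length d +ℕ length d
length-flatten []      = ≡.refl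
length-flatten (_ ∷ d) = cong suc (≡.trans (cong suc (length-flatten d)) (≡.sym (ℕ.+-suc _ _)))

length-pairUp : ∀ k xs → length xs ≡ k +ℕ k → length (pairUp xs) ≡ k
length-pairUp zero [] _ = ≡.refl
length-pairUp (suc k) (x ∷ []) eq with () ← ≡.trans (ℕ.suc-injective eq) (ℕ.+-suc k k)
length-pairUp (suc k) (x ∷ y ∷ xs) eq = cong suc (length-pairUp k xs (ℕ.suc-injective (≡.trans (ℕ.suc-injective eq) (ℕ.+-suc k k))))

norm-pairUp : ∀ k {xs} → length xs ≡ k +ℕ k → Growth 0 xs → norm (pairUp xs) ≡ pairUp xs
norm-pairUp k {xs} len g = ≡.trans (cong (pairUp ∘ relabel [] 0) (flatten-pairUp k xs len))
  (cong pairUp (relabel-id [] ((λ ()) , λ _ → ≡.refl) g))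

diagrams-length : ∀ k → All (λ d → length d ≡ k) (diagrams k)
diagrams-length k = All.map⁺ (All.map (λ {xs} (len , _) → length-pairUp k xs len) (rgs-Growth (k +ℕ k) 0))

diagrams-norm : ∀ k → All (λ d → norm d ≡ d) (diagrams k)
diagrams-norm k = All.map⁺ (All.map (λ (len , g) → norm-pairUp k len g) (rgs-Growth (k +ℕ k) 0))

tuplesOf-length : ∀ c → All (λ ρs → length (bulletAll ρs) ≡ sum c) (tuplesOf c)
tuplesOf-length []      = ≡.refl ∷ []
tuplesOf-length (a ∷ c) = All-concatMap⁺ _ (All.map (λ {d} len → All.map⁺ (All.map (λ {ρs} len′ →
  ≡.trans (length-• d (bulletAll ρs)) (cong₂ _+ℕ_ len len′)) (tuplesOf-length c))) (diagrams-length a))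

tuples-length : ∀ n → All (λ ρs → length (bulletAll ρs) ≡ n) (tuples n)
tuples-length n = All-concatMap⁺ _ (All.map (λ {c} eq → subst (λ m → All (λ ρs → length (bulletAll ρs) ≡ m) (tuplesOf c)) eq (tuplesOf-length c)) (comps-sum n))

-- Finite sums in a commutative ring

module Sums {c ℓ} (R : CommutativeRing c ℓ) where
  open CommutativeRing R renaming (Carrier to K) hiding (zero)
  open import Relation.Binary.Reasoning.Setoid setoid
  open import Algebra.Properties.Ring ring using (-0#≈0#; -‿+-comm)
  open import Algebra.Properties.CommutativeSemigroup +-commutativeSemigroup using (interchange)

  private variable
    a b : Level
    A : Set a
    B : Set b

  ∑ : List A → (A → K) → K
  ∑ xs f = foldr (λ x s → f x + s) 0# xs

  ∑-cong : ∀ (xs : List A) {f g} → (∀ x → f x ≈ g x) → ∑ xs f ≈ ∑ xs g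
  ∑-cong []       f≈g = refl
  ∑-cong (x ∷ xs) f≈g = +-cong (f≈g x) (∑-cong xs f≈g)

  ∑-congᴬ : ∀ {xs : List A} {f g} → All (λ x → f x ≈ g x) xs → ∑ xs f ≈ ∑ xs g
  ∑-congᴬ []         = refl
  ∑-congᴬ (eq ∷ eqs) = +-cong eq (∑-congᴬ eqs)

  ∑-0 : ∀ (xs : List A) → ∑ xs (λ _ → 0#) ≈ 0#
  ∑-0 []       = refl
  ∑-0 (x ∷ xs) = trans (+-identityˡ _) (∑-0 xs)

  ∑-++ : ∀ (xs ys : List A) f → ∑ (xs ++ ys) f ≈ ∑ xs f + ∑ ys f
  ∑-++ []       ys f = sym (+-identityˡ _)
  ∑-++ (x ∷ xs) ys f = trans (+-congˡ (∑-++ xs ys f)) (sym (+-assoc _ _ _))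

  ∑-map : ∀ (g : A → B) xs f → ∑ (map g xs) f ≡ ∑ xs (f ∘ g)
  ∑-map g xs f = List.foldr-map _ g 0# xs

  ∑-concatMap : ∀ (g : A → List B) xs f → ∑ (concatMap g xs) f ≈ ∑ xs (λ x → ∑ (g x) f)
  ∑-concatMap g []       f = refl
  ∑-concatMap g (x ∷ xs) f = trans (∑-++ (g x) (concatMap g xs) f) (+-congˡ (∑-concatMap g xs f))

  ∑-+ : ∀ (xs : List A) f g → ∑ xs (λ x → f x + g x) ≈ ∑ xs f + ∑ xs g
  ∑-+ []       f g = sym (+-identityˡ _)
  ∑-+ (x ∷ xs) f g = trans (+-congˡ (∑-+ xs f g)) (interchange _ _ _ _)

  *-∑ : ∀ k (xs : List A) f → k * ∑ xs f ≈ ∑ xs (λ x → k * f x)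
  *-∑ k []       f = zeroʳ k
  *-∑ k (x ∷ xs) f = trans (distribˡ k _ _) (+-congˡ (*-∑ k xs f))

  -‿∑ : ∀ (xs : List A) f → - ∑ xs f ≈ ∑ xs (λ x → - f x)
  -‿∑ []       f = -0#≈0#
  -‿∑ (x ∷ xs) f = trans (sym (-‿+-comm _ _)) (+-congˡ (-‿∑ xs f))

  ∑-swap : ∀ (xs : List A) (ys : List B) (f : A → B → K) → ∑ xs (λ x → ∑ ys (f x)) ≈ ∑ ys (λ y → ∑ xs (λ x → f x y))
  ∑-swap []       ys f = sym (∑-0 ys)
  ∑-swap (x ∷ xs) ys f = trans (+-congˡ (∑-swap xs ys f)) (sym (∑-+ ys (f x) _))

  -- The Iverson bracket, acting on a scalar.
  ⟦_⟧ : Bool → K → K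
  ⟦ b ⟧ x = if b then x else 0#

  ⟦⟧-cong : ∀ b {x y} → (b ≡ true → x ≈ y) → ⟦ b ⟧ x ≈ ⟦ b ⟧ y
  ⟦⟧-cong true  x≈y = x≈y ≡.refl
  ⟦⟧-cong false x≈y = refl

  *-⟦⟧ : ∀ k b x → k * ⟦ b ⟧ x ≈ ⟦ b ⟧ (k * x)
  *-⟦⟧ k true  x = refl
  *-⟦⟧ k false x = zeroʳ k

  ⟦⟧-∑ : ∀ b (xs : List A) f → ⟦ b ⟧ (∑ xs f) ≈ ∑ xs (λ x → ⟦ b ⟧ (f x))
  ⟦⟧-∑ true  xs f = refl
  ⟦⟧-∑ false xs f = sym (∑-0 xs)

  ∑-if : ∀ b (x : A) f → ∑ (if b then x ∷ [] else []) f ≈ ⟦ b ⟧ (f x)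
  ∑-if true  x f = +-identityʳ _
  ∑-if false x f = refl

  ∑-upTo-suc : ∀ n f → ∑ (upTo (suc n)) f ≈ f 0 + ∑ (upTo n) (f ∘ suc)
  ∑-upTo-suc n f = +-congˡ (reflexive (≡.trans (cong (λ xs → ∑ xs f) (≡.sym (List.map-upTo suc n))) (∑-map suc (upTo n) f)))

  ∑-upTo-last : ∀ n f → ∑ (upTo (suc n)) f ≈ ∑ (upTo n) f + f n
  ∑-upTo-last n f = begin
    ∑ (upTo (suc n)) f      ≡⟨ cong (λ xs → ∑ xs f) (List.upTo-∷ʳ n) ⟨
    ∑ (upTo n ∷ʳ n) f       ≈⟨ ∑-++ (upTo n) (n ∷ []) f ⟩
    ∑ (upTo n) f + (f n + 0#) ≈⟨ +-congˡ (+-identityʳ (f n)) ⟩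
    ∑ (upTo n) f + f n      ∎

  ∑-upTo-single : ∀ n {i} f → i < n → (∀ j → j ≢ i → f j ≈ 0#) → ∑ (upTo n) f ≈ f i
  ∑-upTo-single (suc n) {zero} f _ rest = begin
    ∑ (upTo (suc n)) f         ≈⟨ ∑-upTo-suc n f ⟩
    f 0 + ∑ (upTo n) (f ∘ suc) ≈⟨ +-congˡ (trans (∑-cong (upTo n) (λ j → rest (suc j) λ ())) (∑-0 (upTo n))) ⟩
    f 0 + 0#                   ≈⟨ +-identityʳ (f 0) ⟩
    f 0                        ∎
  ∑-upTo-single (suc n) {suc i} f (s≤s i<n) rest = begin
    ∑ (upTo (suc n)) f         ≈⟨ ∑-upTo-suc n f ⟩
    f 0 + ∑ (upTo n) (f ∘ suc) ≈⟨ +-cong (rest 0 λ ()) (∑-upTo-single n (f ∘ suc) i<n (λ j j≢i → rest (suc j) (j≢i ∘ ℕ.suc-injective))) ⟩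
    0# + f (suc i)             ≈⟨ +-identityˡ _ ⟩
    f (suc i)                  ∎

  -- Sums over enumerations of compositions, tuples and diagrams

  ∑-compsS : ∀ n F → ∑ (compsS (suc n)) F ≈ ∑ (compsS n) (λ c → F (1 ∷ c) + F (bump c))
  ∑-compsS n F = trans (∑-concatMap _ (compsS n) F)
    -- The case split lets the function local to `compsS` compute, which identifies it with `bump`.
    (∑-cong (compsS n) λ { [] → +-congˡ (+-identityʳ _) ; (_ ∷ _) → +-congˡ (+-identityʳ _) })

  -- Prepending `1` produces the compositions with first part `1`; `bump` raises the first part by
  -- one, so induction for `F ∘ bump` produces all the others.
  ∑-comps-∷ : ∀ n F → ∑ (comps (suc n)) F ≈ ∑ (upTo (suc n)) (λ a → ∑ (comps (n ∸ a)) (λ c → F (suc a ∷ c)))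
  ∑-comps-∷ zero    F = sym (+-identityʳ _)
  ∑-comps-∷ (suc n) F = begin
    ∑ (compsS (suc n)) F                                  ≈⟨ ∑-compsS n F ⟩
    ∑ (compsS n) (λ c → F (1 ∷ c) + F (bump c))           ≈⟨ ∑-+ (compsS n) _ _ ⟩
    ∑ (compsS n) (λ c → F (1 ∷ c)) + ∑ (compsS n) (F ∘ bump) ≈⟨ +-congˡ (∑-comps-∷ n (F ∘ bump)) ⟩
    ∑ (compsS n) (λ c → F (1 ∷ c)) + ∑ (upTo (suc n)) (λ a → ∑ (comps (n ∸ a)) (λ c → F (suc (suc a) ∷ c)))
      ≈⟨ ∑-upTo-suc (suc n) (λ a → ∑ (comps (suc n ∸ a)) (λ c → F (suc a ∷ c))) ⟨
    ∑ (upTo (suc (suc n))) (λ a → ∑ (comps (suc n ∸ a)) (λ c → F (suc a ∷ c))) ∎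

  -- `compsS` grows at the front, while here the last part is split off. `G` bundles the two moves
  -- at the front, which commute with appending a last part as long as something stands before it.
  ∑-comps-∷ʳ : ∀ n F → ∑ (comps (suc n)) F ≈ ∑ (upTo (suc n)) (λ a → ∑ (comps a) (λ c → F (c ∷ʳ (suc n ∸ a))))
  ∑-comps-∷ʳ zero    F = sym (+-identityʳ _)
  ∑-comps-∷ʳ (suc n) F = begin
    ∑ (compsS (suc n)) F
      ≈⟨ ∑-compsS n F ⟩
    ∑ (compsS n) G
      ≈⟨ ∑-comps-∷ʳ n G ⟩
    ∑ (upTo (suc n)) (λ a → ∑ (comps a) (λ c → G (c ∷ʳ (suc n ∸ a))))
      ≈⟨ ∑-upTo-suc n _ ⟩
    -- For `a = 0` nothing precedes the last part, and `bump` hits it. The two resulting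
    -- compositions are the summands for `a = 0` and `a = 1` of the target, in the opposite order.
    ((F (1 ∷ suc n ∷ []) + F (suc (suc n) ∷ [])) + 0#) + ∑ (upTo n) (λ a → ∑ (compsS a) (λ c → G (c ∷ʳ (n ∸ a))))
      ≈⟨ +-cong (+-identityʳ _) (∑-cong (upTo n) step) ⟩
    (F (1 ∷ suc n ∷ []) + F (suc (suc n) ∷ [])) + ∑ (upTo n) (λ a → ∑ (compsS (suc a)) (λ c → F (c ∷ʳ (n ∸ a))))
      ≈⟨ +-congʳ (+-comm _ _) ⟩
    (F (suc (suc n) ∷ []) + F (1 ∷ suc n ∷ [])) + ∑ (upTo n) (λ a → ∑ (compsS (suc a)) (λ c → F (c ∷ʳ (n ∸ a))))
      ≈⟨ +-assoc _ _ _ ⟩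
    F (suc (suc n) ∷ []) + (F (1 ∷ suc n ∷ []) + ∑ (upTo n) (λ a → ∑ (compsS (suc a)) (λ c → F (c ∷ʳ (n ∸ a)))))
      ≈⟨ +-cong (+-identityʳ _) (+-congʳ (+-identityʳ _)) ⟨
    (F (suc (suc n) ∷ []) + 0#) + ((F (1 ∷ suc n ∷ []) + 0#) + ∑ (upTo n) (λ a → ∑ (compsS (suc a)) (λ c → F (c ∷ʳ (n ∸ a)))))
      ≈⟨ +-congˡ (∑-upTo-suc n (λ a → ∑ (compsS a) (λ c → F (c ∷ʳ (suc n ∸ a))))) ⟨
    (F (suc (suc n) ∷ []) + 0#) + ∑ (upTo (suc n)) (λ a → ∑ (compsS a) (λ c → F (c ∷ʳ (suc n ∸ a))))
      ≈⟨ ∑-upTo-suc (suc n) (λ a → ∑ (comps a) (λ c → F (c ∷ʳ (suc (suc n) ∸ a)))) ⟨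
    ∑ (upTo (suc (suc n))) (λ a → ∑ (comps a) (λ c → F (c ∷ʳ (suc (suc n) ∸ a)))) ∎
    where
    G : List ℕ → K
    G c = F (1 ∷ c) + F (bump c)
    step : ∀ a → ∑ (compsS a) (λ c → G (c ∷ʳ (n ∸ a))) ≈ ∑ (compsS (suc a)) (λ c → F (c ∷ʳ (n ∸ a)))
    step a = trans
      (∑-congᴬ (All.map (λ {c} eq → +-congˡ (reflexive (cong F (bump-∷ʳ c (n ∸ a) eq)))) (compsS-sum a)))
      (sym (∑-compsS a (λ c → F (c ∷ʳ (n ∸ a)))))

  ∑-tuplesOf-∷ : ∀ a c F → ∑ (tuplesOf (a ∷ c)) F ≈ ∑ (diagrams a) (λ d → ∑ (tuplesOf c) (λ ρs → F (d ∷ ρs)))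
  ∑-tuplesOf-∷ a c F = trans (∑-concatMap _ (diagrams a) F) (∑-cong (diagrams a) λ d → reflexive (∑-map (d ∷_) (tuplesOf c) F))

  ∑-tuplesOf-∷ʳ : ∀ c a F → ∑ (tuplesOf (c ∷ʳ a)) F ≈ ∑ (tuplesOf c) (λ ρs → ∑ (diagrams a) (λ d → F (ρs ∷ʳ d)))
  ∑-tuplesOf-∷ʳ [] a F = begin
    ∑ (tuplesOf (a ∷ [])) F                  ≈⟨ ∑-tuplesOf-∷ a [] F ⟩
    ∑ (diagrams a) (λ d → F (d ∷ []) + 0#)   ≈⟨ ∑-cong (diagrams a) (λ d → +-identityʳ _) ⟩
    ∑ (diagrams a) (λ d → F (d ∷ []))        ≈⟨ +-identityʳ _ ⟨
    ∑ (diagrams a) (λ d → F (d ∷ [])) + 0#   ∎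
  ∑-tuplesOf-∷ʳ (b ∷ c) a F = begin
    ∑ (tuplesOf (b ∷ c ∷ʳ a)) F
      ≈⟨ ∑-tuplesOf-∷ b (c ∷ʳ a) F ⟩
    ∑ (diagrams b) (λ d → ∑ (tuplesOf (c ∷ʳ a)) (λ ρs → F (d ∷ ρs)))
      ≈⟨ ∑-cong (diagrams b) (λ d → ∑-tuplesOf-∷ʳ c a (λ ρs → F (d ∷ ρs))) ⟩
    ∑ (diagrams b) (λ d → ∑ (tuplesOf c) (λ ρs → ∑ (diagrams a) (λ e → F (d ∷ ρs ∷ʳ e))))
      ≈⟨ ∑-tuplesOf-∷ b c (λ ρs → ∑ (diagrams a) (λ e → F (ρs ∷ʳ e))) ⟨
    ∑ (tuplesOf (b ∷ c)) (λ ρs → ∑ (diagrams a) (λ e → F (ρs ∷ʳ e))) ∎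

  ∑-tuples-∷ : ∀ n F → ∑ (tuples (suc n)) F ≈
    ∑ (upTo (suc n)) (λ a → ∑ (diagrams (suc a)) (λ d → ∑ (tuples (n ∸ a)) (λ ρs → F (d ∷ ρs))))
  ∑-tuples-∷ n F = begin
    ∑ (tuples (suc n)) F
      ≈⟨ ∑-concatMap tuplesOf (compsS n) F ⟩
    ∑ (compsS n) (λ c → ∑ (tuplesOf c) F)
      ≈⟨ ∑-comps-∷ n (λ c → ∑ (tuplesOf c) F) ⟩
    ∑ (upTo (suc n)) (λ a → ∑ (comps (n ∸ a)) (λ c → ∑ (tuplesOf (suc a ∷ c)) F))
      ≈⟨ ∑-cong (upTo (suc n)) inner ⟩
    ∑ (upTo (suc n)) (λ a → ∑ (diagrams (suc a)) (λ d → ∑ (tuples (n ∸ a)) (λ ρs → F (d ∷ ρs)))) ∎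
    where
    inner : ∀ a → ∑ (comps (n ∸ a)) (λ c → ∑ (tuplesOf (suc a ∷ c)) F) ≈
      ∑ (diagrams (suc a)) (λ d → ∑ (tuples (n ∸ a)) (λ ρs → F (d ∷ ρs)))
    inner a = begin
      ∑ (comps (n ∸ a)) (λ c → ∑ (tuplesOf (suc a ∷ c)) F)
        ≈⟨ ∑-cong (comps (n ∸ a)) (λ c → ∑-tuplesOf-∷ (suc a) c F) ⟩
      ∑ (comps (n ∸ a)) (λ c → ∑ (diagrams (suc a)) (λ d → ∑ (tuplesOf c) (λ ρs → F (d ∷ ρs))))
        ≈⟨ ∑-swap (comps (n ∸ a)) (diagrams (suc a)) _ ⟩
      ∑ (diagrams (suc a)) (λ d → ∑ (comps (n ∸ a)) (λ c → ∑ (tuplesOf c) (λ ρs → F (d ∷ ρs))))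
        ≈⟨ ∑-cong (diagrams (suc a)) (λ d → ∑-concatMap tuplesOf (comps (n ∸ a)) (λ ρs → F (d ∷ ρs))) ⟨
      ∑ (diagrams (suc a)) (λ d → ∑ (tuples (n ∸ a)) (λ ρs → F (d ∷ ρs))) ∎

  ∑-tuples-∷ʳ : ∀ n F → ∑ (tuples (suc n)) F ≈
    ∑ (upTo (suc n)) (λ a → ∑ (tuples a) (λ ρs → ∑ (diagrams (suc n ∸ a)) (λ d → F (ρs ∷ʳ d))))
  ∑-tuples-∷ʳ n F = begin
    ∑ (tuples (suc n)) F
      ≈⟨ ∑-concatMap tuplesOf (compsS n) F ⟩
    ∑ (compsS n) (λ c → ∑ (tuplesOf c) F)
      ≈⟨ ∑-comps-∷ʳ n (λ c → ∑ (tuplesOf c) F) ⟩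
    ∑ (upTo (suc n)) (λ a → ∑ (comps a) (λ c → ∑ (tuplesOf (c ∷ʳ (suc n ∸ a))) F))
      ≈⟨ ∑-cong (upTo (suc n)) (λ a → trans (∑-cong (comps a) (λ c → ∑-tuplesOf-∷ʳ c (suc n ∸ a) F))
           (sym (∑-concatMap tuplesOf (comps a) _))) ⟩
    ∑ (upTo (suc n)) (λ a → ∑ (tuples a) (λ ρs → ∑ (diagrams (suc n ∸ a)) (λ d → F (ρs ∷ʳ d)))) ∎

  infix 4 _≟L_
  _≟L_ = List.≡-dec ℕ._≟_

  -- Only the strings with the same first letter as `r` contribute, and by induction they do so
  -- once: each restricted growth string is listed exactly once.
  ∑-rgs-single : ∀ n m {r} (h : List ℕ → K) → length r ≡ n → Growth m r → ∑ (rgs n m) (λ xs → ⟦ does (xs ≟L r) ⟧ (h xs)) ≈ h r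
  ∑-rgs-single zero    m {[]} h _ _ = +-identityʳ _
  ∑-rgs-single (suc n) m {a ∷ r} h len (a<1+m ∷ g) = begin
    ∑ (rgs (suc n) m) f                                          ≈⟨ ∑-concatMap (λ b → map (b ∷_) (rgs n (next b m))) (upTo (suc m)) f ⟩
    ∑ (upTo (suc m)) (λ b → ∑ (map (b ∷_) (rgs n (next b m))) f) ≈⟨ ∑-upTo-single (suc m) _ a<1+m others ⟩
    ∑ (map (a ∷_) (rgs n (next a m))) f                          ≡⟨ ∑-map (a ∷_) (rgs n (next a m)) f ⟩
    ∑ (rgs n (next a m)) (λ xs → f (a ∷ xs))                     ≈⟨ ∑-cong (rgs n (next a m)) same ⟩
    ∑ (rgs n (next a m)) (λ xs → ⟦ does (xs ≟L r) ⟧ (h (a ∷ xs)))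
      ≈⟨ ∑-rgs-single n (next a m) (λ xs → h (a ∷ xs)) (ℕ.suc-injective len) g ⟩
    h (a ∷ r) ∎
    where
    f : List ℕ → K
    f xs = ⟦ does (xs ≟L a ∷ r) ⟧ (h xs)
    others : ∀ b → b ≢ a → ∑ (map (b ∷_) (rgs n (next b m))) f ≈ 0#
    others b b≢a = trans (reflexive (∑-map (b ∷_) (rgs n (next b m)) f)) (trans (∑-cong (rgs n (next b m)) vanish) (∑-0 (rgs n (next b m))))
      where
      vanish : ∀ xs → f (b ∷ xs) ≈ 0#
      vanish xs rewrite dec-false (b ℕ.≟ a) b≢a = refl
    same : ∀ xs → f (a ∷ xs) ≈ ⟦ does (xs ≟L r) ⟧ (h (a ∷ xs))
    same xs rewrite dec-true (a ℕ.≟ a) ≡.refl = refl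

  -- Listed diagrams are their own normal forms, so comparing partitions amounts to comparing growth
  -- strings, and only `norm d` survives.
  ∑-diagrams-single : ∀ k d (h : Diagram → K) → length d ≡ k → ∑ (diagrams k) (λ e → ⟦ d ≈D e ⟧ (h e)) ≈ h (norm d)
  ∑-diagrams-single k d h len = begin
    ∑ (diagrams k) (λ e → ⟦ d ≈D e ⟧ (h e))
      ≡⟨ ∑-map pairUp (rgs (k +ℕ k) 0) _ ⟩
    ∑ (rgs (k +ℕ k) 0) (λ xs → ⟦ d ≈D pairUp xs ⟧ (h (pairUp xs)))
      ≈⟨ ∑-congᴬ (All.map (λ {xs} (len′ , g) → reflexive (cong (λ b → ⟦ b ⟧ (h (pairUp xs))) (test xs len′ g))) (rgs-Growth (k +ℕ k) 0)) ⟩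
    ∑ (rgs (k +ℕ k) 0) (λ xs → ⟦ does (xs ≟L r) ⟧ (h (pairUp xs)))
      ≈⟨ ∑-rgs-single (k +ℕ k) 0 (h ∘ pairUp) len-r (relabel-Growth [] 0 (flatten d) invertible-[]) ⟩
    h (norm d) ∎
    where
    r : List ℕ
    r = relabel [] 0 (flatten d)
    len-r : length r ≡ k +ℕ k
    len-r = ≡.trans (relabel-length [] 0 (flatten d)) (≡.trans (length-flatten d) (cong₂ _+ℕ_ len len))
    test : ∀ xs → length xs ≡ k +ℕ k → Growth 0 xs → (d ≈D pairUp xs) ≡ does (xs ≟L r)
    test xs len′ g with xs ≟L r
    ... | yes ≡.refl = dec-true (norm d ≟D norm (norm d)) (≡.sym (norm-idem d))
    ... | no xs≢r = dec-false (norm d ≟D norm (pairUp xs)) λ eq → xs≢r (≡.trans (≡.sym (flatten-pairUp k xs len′))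
      (≡.trans (cong flatten (≡.sym (≡.trans eq (norm-pairUp k len′ g)))) (flatten-pairUp k r len-r)))

-- Iterated products

⊗All : List Diagram → Diagram
⊗All = foldr _⊗D_ []

⊗All-∷ʳ : ∀ ρs G → ⊗All (ρs ∷ʳ G) ≡ ⊗All ρs ⊗D G
⊗All-∷ʳ []       G = ≡.trans (⊗-identityʳ G) (≡.sym (⊗-identityˡ G))
⊗All-∷ʳ (ρ ∷ ρs) G = ≡.trans (cong (ρ ⊗D_) (⊗All-∷ʳ ρs G)) (≡.sym (⊗-assoc ρ (⊗All ρs) G))

⊗All-norm : ∀ ρs → norm (⊗All ρs) ≡ ⊗All ρs
⊗All-norm []       = ≡.refl
⊗All-norm (ρ ∷ ρs) = ⊗-norm ρ (⊗All ρs)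

bulletAll-∷ʳ : ∀ ρs G → bulletAll (ρs ∷ʳ G) ≡ bulletAll ρs •D G
bulletAll-∷ʳ []       G = •-identityʳ G
bulletAll-∷ʳ (ρ ∷ ρs) G = ≡.trans (cong (ρ •D_) (bulletAll-∷ʳ ρs G)) (≡.sym (•-assoc ρ (bulletAll ρs) G))

bulletAll-norm : ∀ ρs → norm (bulletAll ρs) ≡ bulletAll ρs
bulletAll-norm []       = ≡.refl
bulletAll-norm (ρ ∷ ρs) = •-norm ρ (bulletAll ρs)

⊗-congˡ : ∀ d {e e′} → e ~ e′ → d ⊗D e ≡ d ⊗D e′
⊗-congˡ d = ⊗-cong {d} ~-refl

⊗-congʳ : ∀ {d d′} e → d ~ d′ → d ⊗D e ≡ d′ ⊗D e
⊗-congʳ e r = ⊗-cong {e = e} r ~-refl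

EmptyOrIrr : Diagram → Set
EmptyOrIrr d = NonEmpty d → Irr d

factors-≢[] : ∀ d → NonEmpty d → factors d ≢ []
factors-≢[] d ne eq = go [] d ne (≡.trans (≡.sym (factors-≡ d)) eq)
  where
  go : ∀ pre rest → NonEmpty rest → factorsAcc pre rest ≢ []
  go pre (c ∷ rest) _ eq = step (splitTest (pre ∷ʳ c) rest) ≡.refl (empty? rest)
    where
    step : ∀ b → splitTest (pre ∷ʳ c) rest ≡ b → rest ≡ [] ⊎ NonEmpty rest → ⊥
    step true t _ with () ← ≡.trans (≡.sym (factorsAcc-true pre c rest t)) eq
    step false t (inj₂ ne) = go (pre ∷ʳ c) rest ne (≡.trans (≡.sym (factorsAcc-false pre c rest t)) eq)
    step false t (inj₁ ≡.refl)
      with () ← ≡.trans (≡.sym (≡.trans (factorsAcc-false pre c [] t) (factorsAcc-[] (pre ∷ʳ c) (NonEmpty-∷ʳ pre)))) eq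

-- Evaluating the coproduct and the map `S`

module Antipode {c ℓ} (R : CommutativeRing c ℓ) where
  open CommutativeRing R renaming (Carrier to K) hiding (zero)
  open ParSym R
  open Sums R
  open import Relation.Binary.Reasoning.Setoid setoid
  open import Algebra.Properties.Ring ring using (-‿distribˡ-*; -0#≈0#; -‿involutive)
  open import Algebra.Properties.CommutativeSemigroup *-commutativeSemigroup using (x∙yz≈y∙xz)

  private variable
    a : Level
    A : Set a

  ev : V → (Diagram → K) → K
  ev x φ = ∑ x (λ (a , π) → a * φ π)

  ev-cong : ∀ x {φ ψ} → (∀ π → φ π ≈ ψ π) → ev x φ ≈ ev x ψ
  ev-cong x φ≈ψ = ∑-cong x (λ (_ , π) → *-congˡ (φ≈ψ π))

  *-ev : ∀ k x φ → k * ev x φ ≈ ev x (λ π → k * φ π)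
  *-ev k x φ = trans (*-∑ k x _) (∑-cong x (λ (a , π) → x∙yz≈y∙xz k a (φ π)))

  ev-∑ : ∀ x (ys : List A) (f : Diagram → A → K) → ev x (λ π → ∑ ys (f π)) ≈ ∑ ys (λ y → ev x (λ π → f π y))
  ev-∑ x ys f = trans (∑-cong x (λ (a , π) → *-∑ a ys (f π))) (∑-swap x ys _)

  ev-swap : ∀ x y (f : Diagram → Diagram → K) → ev x (λ π → ev y (f π)) ≈ ev y (λ ρ → ev x (λ π → f π ρ))
  ev-swap x y f = trans (ev-∑ x y _) (∑-cong y (λ (b , ρ) → sym (*-ev b x (λ π → f π ρ))))

  ev-H : ∀ π φ → ev (H π) φ ≈ φ π
  ev-H π φ = trans (+-identityʳ _) (*-identityˡ _)

  ev-· : ∀ x y φ → ev (x · y) φ ≈ ev x (λ π → ev y (λ ρ → φ (π ⊗D ρ)))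
  ev-· x y φ = trans (∑-concatMap _ x _) (∑-cong x λ (a , π) →
    trans (reflexive (∑-map _ y _)) (trans (∑-cong y (λ (b , ρ) → *-assoc a b _)) (sym (*-∑ a y _))))

  weight : (Diagram → K) → List Diagram → K
  weight φ ρs = sign (length ρs) * φ (⊗All ρs)

  ev-SIrr : ∀ π φ → ev (SIrr π) φ ≈ ∑ (tuples (length π)) (λ ρs → ⟦ bulletAll ρs ≈D π ⟧ (weight φ ρs))
  ev-SIrr π φ = trans (∑-concatMap _ (tuples (length π)) _)
    (∑-cong (tuples (length π)) (λ ρs → ∑-if (bulletAll ρs ≈D π) _ _))

  -- At order `0` there is one tuple, the empty one, so the formula for irreducible diagrams also
  -- gives the correct value at `∅`. Pairs with an empty entry can therefore be treated like all
  -- others.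
  ev-SIrr-[] : ∀ φ → ev (SIrr []) φ ≈ φ []
  ev-SIrr-[] = ev-H []

  -- Functions of the partition rather than of its labelling: multiplying by `∅` normalises a
  -- diagram, and `φ` must not notice.
  Invariant : (Diagram → K) → Set ℓ
  Invariant φ = ∀ π → φ (norm π) ≈ φ π

  -- The factors of `G ⊗D t` are those of `t`, preceded by `G` unless it is empty, and `SH`
  -- multiplies the leading factor on the right: this is the reversal of order under `S`.
  ev-SH-⊗ : ∀ G t {φ} → EmptyOrIrr G → norm G ≡ G → Invariant φ →
    ev (SH (G ⊗D t)) φ ≈ ev (SH t) (λ σ → ev (SIrr G) (λ ρ → φ (σ ⊗D ρ)))
  ev-SH-⊗ G t {φ} irr normal inv = trans (reflexive (cong (λ fs → ev (rec fs) φ) (factors-⊗ G t))) (go (empty? G))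
    where
    rec : List Diagram → V
    rec = foldr (λ f v → v · SIrr f) (H [])
    go : G ≡ [] ⊎ NonEmpty G → ev (rec (factors G ++ factors t)) φ ≈ ev (SH t) (λ σ → ev (SIrr G) (λ ρ → φ (σ ⊗D ρ)))
    go (inj₁ ≡.refl) = ev-cong (SH t) (λ σ → sym (trans (ev-SIrr-[] (λ ρ → φ (σ ⊗D ρ))) (trans (reflexive (cong φ (⊗-identityʳ σ))) (inv σ))))
    go (inj₂ ne) = trans (reflexive (cong (λ fs → ev (rec (fs ++ factors t)) φ) (≡.trans (factors-Irr (irr ne)) (cong (_∷ []) normal))))
      (ev-· (SH t) (SIrr G) φ)

  splits : ℕ → Diagram → (Diagram → Diagram → K) → K
  splits n f X = ∑ (upTo (suc n)) (λ a → ∑ (diagrams a) (λ G₁ → ∑ (diagrams (n ∸ a)) (λ G₂ →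
    ⟦ (G₁ •D G₂) ≈D f ⟧ (X G₁ G₂))))

  -- Whenever `G₁ •D G₂` represents the irreducible `f`, `Irr-•ˡ` and `Irr-•ʳ` make the tests on
  -- `G₁` and `G₂` succeed, so `splits` can omit them. For the same reason `F` and `X` need to be
  -- compared only on irreducible or empty diagrams.
  ∑-ΔIrr : ∀ {f} (F : K × Diagram × Diagram → K) X → Irr f →
    (∀ G₁ G₂ → EmptyOrIrr G₁ → EmptyOrIrr G₂ → norm G₁ ≡ G₁ → norm G₂ ≡ G₂ → F (1# , G₁ , G₂) ≈ X G₁ G₂) →
    ∑ (ΔIrr f) F ≈ splits (length f) f X
  ∑-ΔIrr {f} F X irr F≈X = begin
    ∑ (concatMap row (upTo (suc (length f)))) F
      ≈⟨ ∑-concatMap row (upTo (suc (length f))) F ⟩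
    ∑ (upTo (suc (length f))) (λ a → ∑ (row a) F)
      ≈⟨ ∑-cong (upTo (suc (length f))) (λ a → ∑-concatMap (cells a) (diagrams a) F) ⟩
    ∑ (upTo (suc (length f))) (λ a → ∑ (diagrams a) (λ G₁ → ∑ (cells a G₁) F))
      ≈⟨ ∑-cong (upTo (suc (length f))) (λ a → ∑-congᴬ (All.map (cells-≈ a) (diagrams-norm a))) ⟩
    splits (length f) f X ∎
    where
    cell : Diagram → Diagram → T
    cell G₁ G₂ = if emptyOrIrr G₁ ∧ emptyOrIrr G₂ ∧ ((G₁ •D G₂) ≈D f) then (1# , G₁ , G₂) ∷ [] else []
    cells : ℕ → Diagram → T
    cells a G₁ = concatMap (cell G₁) (diagrams (length f ∸ a))
    row : ℕ → T
    row a = concatMap (cells a) (diagrams a)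
    complete : ∀ {d} → EmptyOrIrr d → emptyOrIrr d ≡ true
    complete {[]} _ = ≡.refl
    complete {_ ∷ _} i = irreducible-complete (i tt)
    irrˡ : ∀ G₁ G₂ → ((G₁ •D G₂) ≈D f) ≡ true → EmptyOrIrr G₁
    irrˡ G₁ G₂ eq ne = Irr-•ˡ G₁ G₂ ne (Irr-resp (~-sym (≈D⇒~ (G₁ •D G₂) f eq)) irr)
    irrʳ : ∀ G₁ G₂ → ((G₁ •D G₂) ≈D f) ≡ true → EmptyOrIrr G₂
    irrʳ G₁ G₂ eq ne = Irr-•ʳ G₁ G₂ ne (Irr-resp (~-sym (≈D⇒~ (G₁ •D G₂) f eq)) irr)
    cell-≈ : ∀ G₁ G₂ → norm G₁ ≡ G₁ → norm G₂ ≡ G₂ → ∑ (cell G₁ G₂) F ≈ ⟦ (G₁ •D G₂) ≈D f ⟧ (X G₁ G₂)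
    term : ∀ G₁ G₂ → norm G₁ ≡ G₁ → norm G₂ ≡ G₂ →
      ⟦ emptyOrIrr G₁ ∧ emptyOrIrr G₂ ∧ ((G₁ •D G₂) ≈D f) ⟧ (F (1# , G₁ , G₂)) ≈ ⟦ (G₁ •D G₂) ≈D f ⟧ (X G₁ G₂)
    term G₁ G₂ n₁ n₂ with (G₁ •D G₂) ≈D f in eq
    ... | true rewrite complete {G₁} (irrˡ G₁ G₂ eq) | complete {G₂} (irrʳ G₁ G₂ eq) =
      F≈X G₁ G₂ (irrˡ G₁ G₂ eq) (irrʳ G₁ G₂ eq) n₁ n₂
    ... | false with emptyOrIrr G₁ | emptyOrIrr G₂
    ... | true  | true  = refl
    ... | true  | false = refl
    ... | false | _     = refl

    cell-≈ G₁ G₂ n₁ n₂ = trans (∑-if (emptyOrIrr G₁ ∧ emptyOrIrr G₂ ∧ ((G₁ •D G₂) ≈D f)) (1# , G₁ , G₂) F) (term G₁ G₂ n₁ n₂)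
    cells-≈ : ∀ a {G₁} → norm G₁ ≡ G₁ →
      ∑ (cells a G₁) F ≈ ∑ (diagrams (length f ∸ a)) (λ G₂ → ⟦ (G₁ •D G₂) ≈D f ⟧ (X G₁ G₂))
    cells-≈ a {G₁} n₁ = trans (∑-concatMap (cell G₁) (diagrams (length f ∸ a)) F)
      (∑-congᴬ (All.map (λ {G₂} n₂ → cell-≈ G₁ G₂ n₁ n₂) (diagrams-norm (length f ∸ a))))

  -- G is eliminated by the condition bulletAll ρs ≈ G, which turns the double sum coming from a coproduct
  -- followed by an antipode into a single sum over tuples.
  ∑-SIrr : ∀ k (h : Diagram → Diagram → K) →
    ∑ (diagrams k) (λ G → ev (SIrr G) (h G)) ≈ ∑ (tuples k) (λ ρs → weight (h (bulletAll ρs)) ρs)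
  ∑-SIrr k h = begin
    ∑ (diagrams k) (λ G → ev (SIrr G) (h G))
      ≈⟨ ∑-congᴬ (All.map (λ {G} len → trans (ev-SIrr G (h G)) (reflexive (cong (λ n → ∑ (tuples n) _) len))) (diagrams-length k)) ⟩
    ∑ (diagrams k) (λ G → ∑ (tuples k) (λ ρs → ⟦ bulletAll ρs ≈D G ⟧ (weight (h G) ρs)))
      ≈⟨ ∑-swap (diagrams k) (tuples k) _ ⟩
    ∑ (tuples k) (λ ρs → ∑ (diagrams k) (λ G → ⟦ bulletAll ρs ≈D G ⟧ (weight (h G) ρs)))
      ≈⟨ ∑-congᴬ (All.map (λ {ρs} len → trans (∑-diagrams-single k (bulletAll ρs) (λ G → weight (h G) ρs) len)
           (reflexive (cong (λ G → weight (h G) ρs) (bulletAll-norm ρs)))) (tuples-length k)) ⟩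
    ∑ (tuples k) (λ ρs → weight (h (bulletAll ρs)) ρs) ∎

  ⟦⟧-ev : ∀ b x φ → ⟦ b ⟧ (ev x φ) ≈ ev x (λ π → ⟦ b ⟧ (φ π))
  ⟦⟧-ev b x φ = trans (⟦⟧-∑ b x _) (∑-cong x (λ (a , π) → sym (*-⟦⟧ a b (φ π))))

  weight-∑ : ∀ ρs (xs : List A) (b : A → Bool) (φ : A → Diagram → K) →
    weight (λ π → ∑ xs (λ x → ⟦ b x ⟧ (φ x π))) ρs ≈ ∑ xs (λ x → ⟦ b x ⟧ (weight (φ x) ρs))
  weight-∑ ρs xs b φ = trans (*-∑ (sign (length ρs)) xs _) (∑-cong xs (λ x → *-⟦⟧ (sign (length ρs)) (b x) (φ x (⊗All ρs))))

  -x*y : ∀ x y → x * y ≈ - (- x * y)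
  -x*y x y = trans (sym (-‿involutive _)) (-‿cong (-‿distribˡ-* x y))

  ⟦⟧-neg : ∀ b x → ⟦ b ⟧ (- x) ≈ - ⟦ b ⟧ x
  ⟦⟧-neg true  x = refl
  ⟦⟧-neg false x = sym -0#≈0#

  -- Cancellation for one irreducible diagram

  module _ (f : Diagram) (ψ : Diagram → K) where

    term : List Diagram → K
    term ρs = ⟦ bulletAll ρs ≈D f ⟧ (weight ψ ρs)

    term-∷ : ∀ G ρs → ⟦ (G •D bulletAll ρs) ≈D f ⟧ (weight (λ ρ → ψ (G ⊗D ρ)) ρs) ≈ - term (G ∷ ρs)
    term-∷ G ρs = trans (⟦⟧-cong ((G •D bulletAll ρs) ≈D f) (λ _ → -x*y _ _)) (⟦⟧-neg ((G •D bulletAll ρs) ≈D f) _)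

    term-∷ʳ : ∀ ρs G → ⟦ (bulletAll ρs •D G) ≈D f ⟧ (weight (λ ρ → ψ (ρ ⊗D G)) ρs) ≈ - term (ρs ∷ʳ G)
    term-∷ʳ ρs G = begin
      ⟦ (bulletAll ρs •D G) ≈D f ⟧ (sign (length ρs) * ψ (⊗All ρs ⊗D G))
        ≡⟨ cong₂ (λ d e → ⟦ d ≈D f ⟧ (sign (length ρs) * ψ e)) (bulletAll-∷ʳ ρs G) (⊗All-∷ʳ ρs G) ⟨
      ⟦ b ⟧ (sign (length ρs) * ψ (⊗All (ρs ∷ʳ G)))
        ≈⟨ ⟦⟧-cong b (λ _ → -x*y _ _) ⟩
      ⟦ b ⟧ (- (sign (suc (length ρs)) * ψ (⊗All (ρs ∷ʳ G))))
        ≈⟨ ⟦⟧-neg b _ ⟩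
      - ⟦ b ⟧ (sign (suc (length ρs)) * ψ (⊗All (ρs ∷ʳ G)))
        ≡⟨ cong (λ n → - ⟦ b ⟧ (sign n * ψ (⊗All (ρs ∷ʳ G)))) (≡.trans (List.length-++ ρs) (ℕ.+-comm (length ρs) 1)) ⟨
      - term (ρs ∷ʳ G) ∎
      where b = bulletAll (ρs ∷ʳ G) ≈D f

    term-∷-[] : ∀ ρs → ⟦ ([] •D bulletAll ρs) ≈D f ⟧ (weight (λ ρ → ψ ([] ⊗D ρ)) ρs) ≈ term ρs
    term-∷-[] ρs = reflexive (cong₂ (λ d e → ⟦ d ≈D f ⟧ (sign (length ρs) * ψ e)) (bulletAll-norm ρs)
      (≡.trans (⊗-identityˡ (⊗All ρs)) (⊗All-norm ρs)))

    term-∷ʳ-[] : ∀ ρs → ⟦ (bulletAll ρs •D []) ≈D f ⟧ (weight (λ ρ → ψ (ρ ⊗D [])) ρs) ≈ term ρs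
    term-∷ʳ-[] ρs = reflexive (cong₂ (λ d e → ⟦ d ≈D f ⟧ (sign (length ρs) * ψ e))
      (≡.trans (•-identityʳ (bulletAll ρs)) (bulletAll-norm ρs)) (≡.trans (⊗-identityʳ (⊗All ρs)) (⊗All-norm ρs)))

    splits-S⊗id : ∀ n → splits (suc n) f (λ G₁ G₂ → ev (SIrr G₁) (λ ρ → ψ (ρ ⊗D G₂))) ≈ 0#
    splits-S⊗id n = begin
      splits (suc n) f (λ G₁ G₂ → ev (SIrr G₁) (λ ρ → ψ (ρ ⊗D G₂)))
        ≈⟨ ∑-cong (upTo (suc (suc n))) (λ a → eliminate a (suc n ∸ a)) ⟩
      ∑ (upTo (suc (suc n))) (λ a → P a (suc n ∸ a))
        -- Order `suc n` for `G₁` leaves only `G₂ = ∅`; every smaller order leaves a nonempty `G₂`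
        -- to be appended to the tuple.
        ≈⟨ ∑-upTo-last (suc n) (λ a → P a (suc n ∸ a)) ⟩
      ∑ (upTo (suc n)) (λ a → P a (suc n ∸ a)) + P (suc n) (suc n ∸ suc n)
        ≈⟨ +-cong proper whole ⟩
      - ∑ (tuples (suc n)) term + ∑ (tuples (suc n)) term
        ≈⟨ -‿inverseˡ _ ⟩
      0# ∎
      where
      P : ℕ → ℕ → K
      P a b = ∑ (tuples a) (λ ρs → ∑ (diagrams b) (λ G → ⟦ (bulletAll ρs •D G) ≈D f ⟧ (weight (λ ρ → ψ (ρ ⊗D G)) ρs)))
      eliminate : ∀ a b → ∑ (diagrams a) (λ G₁ → ∑ (diagrams b) (λ G₂ →
        ⟦ (G₁ •D G₂) ≈D f ⟧ (ev (SIrr G₁) (λ ρ → ψ (ρ ⊗D G₂))))) ≈ P a b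
      eliminate a b = begin
        ∑ (diagrams a) (λ G₁ → ∑ (diagrams b) (λ G₂ → ⟦ (G₁ •D G₂) ≈D f ⟧ (ev (SIrr G₁) (λ ρ → ψ (ρ ⊗D G₂)))))
          -- Bracket and sum over `G₂` move inside the evaluation, where `∑-SIrr` can replace `G₁`
          -- by `bulletAll ρs`.
          ≈⟨ ∑-cong (diagrams a) (λ G₁ → ∑-cong (diagrams b) (λ G₂ → ⟦⟧-ev ((G₁ •D G₂) ≈D f) (SIrr G₁) _)) ⟩
        ∑ (diagrams a) (λ G₁ → ∑ (diagrams b) (λ G₂ → ev (SIrr G₁) (λ ρ → ⟦ (G₁ •D G₂) ≈D f ⟧ (ψ (ρ ⊗D G₂)))))
          ≈⟨ ∑-cong (diagrams a) (λ G₁ → ev-∑ (SIrr G₁) (diagrams b) _) ⟨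
        ∑ (diagrams a) (λ G₁ → ev (SIrr G₁) (λ ρ → ∑ (diagrams b) (λ G₂ → ⟦ (G₁ •D G₂) ≈D f ⟧ (ψ (ρ ⊗D G₂)))))
          ≈⟨ ∑-SIrr a (λ G₁ ρ → ∑ (diagrams b) (λ G₂ → ⟦ (G₁ •D G₂) ≈D f ⟧ (ψ (ρ ⊗D G₂)))) ⟩
        ∑ (tuples a) (λ ρs → weight (λ ρ → ∑ (diagrams b) (λ G₂ → ⟦ (bulletAll ρs •D G₂) ≈D f ⟧ (ψ (ρ ⊗D G₂)))) ρs)
          ≈⟨ ∑-cong (tuples a) (λ ρs → weight-∑ ρs (diagrams b) (λ G → (bulletAll ρs •D G) ≈D f) (λ G ρ → ψ (ρ ⊗D G))) ⟩
        P a b ∎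
      proper : ∑ (upTo (suc n)) (λ a → P a (suc n ∸ a)) ≈ - ∑ (tuples (suc n)) term
      proper = begin
        ∑ (upTo (suc n)) (λ a → P a (suc n ∸ a))
          ≈⟨ ∑-cong (upTo (suc n)) (λ a → ∑-cong (tuples a) (λ ρs →
               trans (∑-cong (diagrams (suc n ∸ a)) (term-∷ʳ ρs)) (sym (-‿∑ (diagrams (suc n ∸ a)) _)))) ⟩
        ∑ (upTo (suc n)) (λ a → ∑ (tuples a) (λ ρs → - ∑ (diagrams (suc n ∸ a)) (λ G → term (ρs ∷ʳ G))))
          ≈⟨ ∑-cong (upTo (suc n)) (λ a → -‿∑ (tuples a) _) ⟨
        ∑ (upTo (suc n)) (λ a → - ∑ (tuples a) (λ ρs → ∑ (diagrams (suc n ∸ a)) (λ G → term (ρs ∷ʳ G))))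
          ≈⟨ -‿∑ (upTo (suc n)) _ ⟨
        - ∑ (upTo (suc n)) (λ a → ∑ (tuples a) (λ ρs → ∑ (diagrams (suc n ∸ a)) (λ G → term (ρs ∷ʳ G))))
          ≈⟨ -‿cong (∑-tuples-∷ʳ n term) ⟨
        - ∑ (tuples (suc n)) term ∎
      whole : P (suc n) (n ∸ n) ≈ ∑ (tuples (suc n)) term
      whole = trans (reflexive (cong (P (suc n)) (ℕ.n∸n≡0 n)))
        (∑-cong (tuples (suc n)) (λ ρs → trans (+-identityʳ _) (term-∷ʳ-[] ρs)))

    splits-id⊗S : ∀ n → splits (suc n) f (λ G₁ G₂ → ev (SIrr G₂) (λ ρ → ψ (G₁ ⊗D ρ))) ≈ 0#
    splits-id⊗S n = begin
      splits (suc n) f (λ G₁ G₂ → ev (SIrr G₂) (λ ρ → ψ (G₁ ⊗D ρ)))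
        ≈⟨ ∑-cong (upTo (suc (suc n))) (λ a → eliminate a (suc n ∸ a)) ⟩
      ∑ (upTo (suc (suc n))) (λ a → Q a (suc n ∸ a))
        -- Now `G₁ = ∅`, at the first index, is set apart; the other `G₁` are prepended to the
        -- tuple.
        ≈⟨ ∑-upTo-suc (suc n) (λ a → Q a (suc n ∸ a)) ⟩
      Q 0 (suc n) + ∑ (upTo (suc n)) (λ a → Q (suc a) (n ∸ a))
        ≈⟨ +-cong whole proper ⟩
      ∑ (tuples (suc n)) term - ∑ (tuples (suc n)) term
        ≈⟨ -‿inverseʳ _ ⟩
      0# ∎
      where
      Q : ℕ → ℕ → K
      Q a b = ∑ (diagrams a) (λ G → ∑ (tuples b) (λ ρs → ⟦ (G •D bulletAll ρs) ≈D f ⟧ (weight (λ ρ → ψ (G ⊗D ρ)) ρs)))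
      eliminate : ∀ a b → ∑ (diagrams a) (λ G₁ → ∑ (diagrams b) (λ G₂ →
        ⟦ (G₁ •D G₂) ≈D f ⟧ (ev (SIrr G₂) (λ ρ → ψ (G₁ ⊗D ρ))))) ≈ Q a b
      eliminate a b = ∑-cong (diagrams a) λ G₁ → begin
        ∑ (diagrams b) (λ G₂ → ⟦ (G₁ •D G₂) ≈D f ⟧ (ev (SIrr G₂) (λ ρ → ψ (G₁ ⊗D ρ))))
          ≈⟨ ∑-cong (diagrams b) (λ G₂ → ⟦⟧-ev ((G₁ •D G₂) ≈D f) (SIrr G₂) _) ⟩
        ∑ (diagrams b) (λ G₂ → ev (SIrr G₂) (λ ρ → ⟦ (G₁ •D G₂) ≈D f ⟧ (ψ (G₁ ⊗D ρ))))
          ≈⟨ ∑-SIrr b (λ G₂ ρ → ⟦ (G₁ •D G₂) ≈D f ⟧ (ψ (G₁ ⊗D ρ))) ⟩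
        ∑ (tuples b) (λ ρs → weight (λ ρ → ⟦ (G₁ •D bulletAll ρs) ≈D f ⟧ (ψ (G₁ ⊗D ρ))) ρs)
          ≈⟨ ∑-cong (tuples b) (λ ρs → *-⟦⟧ _ ((G₁ •D bulletAll ρs) ≈D f) _) ⟩
        ∑ (tuples b) (λ ρs → ⟦ (G₁ •D bulletAll ρs) ≈D f ⟧ (weight (λ ρ → ψ (G₁ ⊗D ρ)) ρs)) ∎
      whole : Q 0 (suc n) ≈ ∑ (tuples (suc n)) term
      whole = trans (+-identityʳ _) (∑-cong (tuples (suc n)) term-∷-[])
      proper : ∑ (upTo (suc n)) (λ a → Q (suc a) (n ∸ a)) ≈ - ∑ (tuples (suc n)) term
      proper = begin
        ∑ (upTo (suc n)) (λ a → Q (suc a) (n ∸ a))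
          ≈⟨ ∑-cong (upTo (suc n)) (λ a → ∑-cong (diagrams (suc a)) (λ G →
               trans (∑-cong (tuples (n ∸ a)) (term-∷ G)) (sym (-‿∑ (tuples (n ∸ a)) _)))) ⟩
        ∑ (upTo (suc n)) (λ a → ∑ (diagrams (suc a)) (λ G → - ∑ (tuples (n ∸ a)) (λ ρs → term (G ∷ ρs))))
          ≈⟨ ∑-cong (upTo (suc n)) (λ a → -‿∑ (diagrams (suc a)) _) ⟨
        ∑ (upTo (suc n)) (λ a → - ∑ (diagrams (suc a)) (λ G → ∑ (tuples (n ∸ a)) (λ ρs → term (G ∷ ρs))))
          ≈⟨ -‿∑ (upTo (suc n)) _ ⟨
        - ∑ (upTo (suc n)) (λ a → ∑ (diagrams (suc a)) (λ G → ∑ (tuples (n ∸ a)) (λ ρs → term (G ∷ ρs))))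
          ≈⟨ -‿cong (∑-tuples-∷ n term) ⟨
        - ∑ (tuples (suc n)) term ∎

  -- The cancellation requires positive order, since for `∅` the value at the unit would remain;
  -- irreducibility supplies it.
  splits-vanish : ∀ {f X} → Irr f → (∀ n → splits (suc n) f X ≈ 0#) → splits (length f) f X ≈ 0#
  splits-vanish {_ ∷ f} _ vanish = vanish (length f)
  splits-vanish {[]} i _ with () ← Irr.inhabited i

  -- Products of several irreducible factors

  ev-S⊗id ev-id⊗S : T → (Diagram → K) → K
  ev-S⊗id t φ = ∑ t (λ (b , π , ρ) → b * ev (SH π) (λ σ → φ (σ ⊗D ρ)))
  ev-id⊗S t φ = ∑ t (λ (b , π , ρ) → b * ev (SH ρ) (λ σ → φ (π ⊗D σ)))

  ∑-·T : ∀ x y (F : K × Diagram × Diagram → K) →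
    ∑ (x ·T y) F ≈ ∑ x (λ (a , π , ρ) → ∑ y (λ (b , π′ , ρ′) → F (a * b , π ⊗D π′ , ρ ⊗D ρ′)))
  ∑-·T x y F = trans (∑-concatMap _ x F) (∑-cong x (λ _ → reflexive (∑-map _ y F)))

  ⊗-invariantˡ : ∀ (φ : Diagram → K) ρ → Invariant (λ π → φ (π ⊗D ρ))
  ⊗-invariantˡ φ ρ π = reflexive (cong φ (⊗-congʳ ρ (~-sym (~-norm π))))

  ⊗-invariantʳ : ∀ (φ : Diagram → K) π → Invariant (λ ρ → φ (π ⊗D ρ))
  ⊗-invariantʳ φ π ρ = reflexive (cong φ (⊗-congˡ π (~-sym (~-norm ρ))))

  -- Reversal turns each term into `S(π) S(G₁) G₂ ρ`, with the sum over `G₁` and `G₂` adjacent in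
  -- the middle. The outer factors are absorbed into `ψ`, and the sum vanishes whatever `t` is.
  ev-S⊗id-·T : ∀ {f} → Irr f → ∀ t φ → ev-S⊗id (ΔIrr f ·T t) φ ≈ 0#
  ev-S⊗id-·T {f} irr t φ = begin
    ev-S⊗id (ΔIrr f ·T t) φ
      ≈⟨ ∑-·T (ΔIrr f) t _ ⟩
    ∑ (ΔIrr f) (λ x → ∑ t (λ y → F y x))
      ≈⟨ ∑-swap (ΔIrr f) t _ ⟩
    ∑ t (λ y → ∑ (ΔIrr f) (F y))
      ≈⟨ ∑-cong t (λ y → trans (∑-ΔIrr (F y) (λ G₁ G₂ → ev (SIrr G₁) (λ ρ → ψ y (ρ ⊗D G₂))) irr (rearrange y))
           (splits-vanish irr (splits-S⊗id f (ψ y)))) ⟩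
    ∑ t (λ _ → 0#)
      ≈⟨ ∑-0 t ⟩
    0# ∎
    where
    F : K × Diagram × Diagram → K × Diagram × Diagram → K
    F (b , π , ρ) (a , G₁ , G₂) = (a * b) * ev (SH (G₁ ⊗D π)) (λ σ → φ (σ ⊗D (G₂ ⊗D ρ)))
    ψ : K × Diagram × Diagram → Diagram → K
    ψ (b , π , ρ) τ = b * ev (SH π) (λ σ → φ ((σ ⊗D τ) ⊗D ρ))
    reassociate : ∀ σ τ G ρ → (σ ⊗D τ) ⊗D (G ⊗D ρ) ≡ (σ ⊗D (τ ⊗D G)) ⊗D ρ
    reassociate σ τ G ρ = ≡.trans (≡.sym (⊗-assoc (σ ⊗D τ) G ρ)) (cong (_⊗D ρ) (⊗-assoc σ τ G))
    rearrange : ∀ y G₁ G₂ → EmptyOrIrr G₁ → EmptyOrIrr G₂ → norm G₁ ≡ G₁ → norm G₂ ≡ G₂ →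
      F y (1# , G₁ , G₂) ≈ ev (SIrr G₁) (λ ρ → ψ y (ρ ⊗D G₂))
    rearrange (b , π , ρ) G₁ G₂ i₁ _ n₁ _ = begin
      (1# * b) * ev (SH (G₁ ⊗D π)) (λ σ → φ (σ ⊗D (G₂ ⊗D ρ)))
        ≈⟨ *-cong (*-identityˡ b) (ev-SH-⊗ G₁ π i₁ n₁ (⊗-invariantˡ φ (G₂ ⊗D ρ))) ⟩
      b * ev (SH π) (λ σ → ev (SIrr G₁) (λ τ → φ ((σ ⊗D τ) ⊗D (G₂ ⊗D ρ))))
        ≈⟨ *-congˡ (ev-swap (SH π) (SIrr G₁) _) ⟩
      b * ev (SIrr G₁) (λ τ → ev (SH π) (λ σ → φ ((σ ⊗D τ) ⊗D (G₂ ⊗D ρ))))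
        ≈⟨ *-ev b (SIrr G₁) _ ⟩
      ev (SIrr G₁) (λ τ → b * ev (SH π) (λ σ → φ ((σ ⊗D τ) ⊗D (G₂ ⊗D ρ))))
        ≈⟨ ev-cong (SIrr G₁) (λ τ → *-congˡ (ev-cong (SH π) (λ σ → reflexive (cong φ (reassociate σ τ G₂ ρ))))) ⟩
      ev (SIrr G₁) (λ τ → b * ev (SH π) (λ σ → φ ((σ ⊗D (τ ⊗D G₂)) ⊗D ρ))) ∎

  ΔFactors : List Diagram → T
  ΔFactors = foldr (λ f t → ΔIrr f ·T t) oneT

  -- Each term is `G₁ π S(ρ) S(G₂)`, with the remaining factors enclosed. These are contracted
  -- first, by induction for `φ` precomposed with multiplication by `G₁` and `τ`; then `G₁` and
  -- `S(G₂)` become adjacent and cancel.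
  ev-id⊗S-ΔFactors : ∀ {fs} → All Irr fs → ∀ {φ} → Invariant φ → ev-id⊗S (ΔFactors fs) φ ≈ ⟦ null fs ⟧ (φ [])
  ev-id⊗S-ΔFactors [] {φ} inv = trans (+-identityʳ _) (trans (*-identityˡ _) (ev-H [] φ))
  ev-id⊗S-ΔFactors {f ∷ fs} (irr ∷ irrs) {φ} inv = begin
    ev-id⊗S (ΔIrr f ·T t) φ
      ≈⟨ ∑-·T (ΔIrr f) t _ ⟩
    ∑ (ΔIrr f) F
      ≈⟨ ∑-ΔIrr F (λ G₁ G₂ → ev (SIrr G₂) (λ ρ → ψ (G₁ ⊗D ρ))) irr rearrange ⟩
    splits (length f) f (λ G₁ G₂ → ev (SIrr G₂) (λ ρ → ψ (G₁ ⊗D ρ)))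
      ≈⟨ splits-vanish irr (splits-id⊗S f ψ) ⟩
    0# ∎
    where
    t : T
    t = ΔFactors fs
    F : K × Diagram × Diagram → K
    F (a , G₁ , G₂) = ∑ t (λ (b , π , ρ) → (a * b) * ev (SH (G₂ ⊗D ρ)) (λ σ → φ ((G₁ ⊗D π) ⊗D σ)))
    ψ : Diagram → K
    -- The bracket is the outcome of the induction: the remaining factors contribute the unit if
    -- there are none, and zero otherwise.
    ψ π = ⟦ null fs ⟧ (φ π)
    reassociate : ∀ G π σ ρ → (G ⊗D π) ⊗D (σ ⊗D ρ) ≡ (G ⊗D (π ⊗D σ)) ⊗D ρ
    reassociate G π σ ρ = ≡.trans (≡.sym (⊗-assoc (G ⊗D π) σ ρ)) (cong (_⊗D ρ) (⊗-assoc G π σ))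
    rearrange : ∀ G₁ G₂ → EmptyOrIrr G₁ → EmptyOrIrr G₂ → norm G₁ ≡ G₁ → norm G₂ ≡ G₂ →
      F (1# , G₁ , G₂) ≈ ev (SIrr G₂) (λ ρ → ψ (G₁ ⊗D ρ))
    rearrange G₁ G₂ _ i₂ _ n₂ = begin
      ∑ t (λ (b , π , ρ) → (1# * b) * ev (SH (G₂ ⊗D ρ)) (λ σ → φ ((G₁ ⊗D π) ⊗D σ)))
        ≈⟨ ∑-cong t each ⟩
      ∑ t (λ (b , π , ρ) → ev (SIrr G₂) (λ τ → b * ev (SH ρ) (λ σ → φ ((G₁ ⊗D (π ⊗D σ)) ⊗D τ))))
        ≈⟨ ev-∑ (SIrr G₂) t _ ⟨
      ev (SIrr G₂) (λ τ → ev-id⊗S t (λ π → φ ((G₁ ⊗D π) ⊗D τ)))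
        ≈⟨ ev-cong (SIrr G₂) (λ τ → trans (ev-id⊗S-ΔFactors irrs (⊗-invariantʳ (λ π → φ (π ⊗D τ)) G₁))
             (reflexive (cong (λ π → ⟦ null fs ⟧ (φ π)) (unit τ)))) ⟩
      ev (SIrr G₂) (λ τ → ψ (G₁ ⊗D τ)) ∎
      where
      unit : ∀ τ → (G₁ ⊗D []) ⊗D τ ≡ G₁ ⊗D τ
      unit τ = ⊗-congʳ τ (~-trans (≡⇒~ (⊗-identityʳ G₁)) (~-sym (~-norm G₁)))
      each : ∀ y → let (b , π , ρ) = y in (1# * b) * ev (SH (G₂ ⊗D ρ)) (λ σ → φ ((G₁ ⊗D π) ⊗D σ)) ≈
        ev (SIrr G₂) (λ τ → b * ev (SH ρ) (λ σ → φ ((G₁ ⊗D (π ⊗D σ)) ⊗D τ)))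
      each (b , π , ρ) = begin
        (1# * b) * ev (SH (G₂ ⊗D ρ)) (λ σ → φ ((G₁ ⊗D π) ⊗D σ))
          ≈⟨ *-cong (*-identityˡ b) (ev-SH-⊗ G₂ ρ i₂ n₂ (⊗-invariantʳ φ (G₁ ⊗D π))) ⟩
        b * ev (SH ρ) (λ σ → ev (SIrr G₂) (λ τ → φ ((G₁ ⊗D π) ⊗D (σ ⊗D τ))))
          ≈⟨ *-congˡ (ev-swap (SH ρ) (SIrr G₂) _) ⟩
        b * ev (SIrr G₂) (λ τ → ev (SH ρ) (λ σ → φ ((G₁ ⊗D π) ⊗D (σ ⊗D τ))))
          ≈⟨ *-ev b (SIrr G₂) _ ⟩
        ev (SIrr G₂) (λ τ → b * ev (SH ρ) (λ σ → φ ((G₁ ⊗D π) ⊗D (σ ⊗D τ))))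
          ≈⟨ ev-cong (SIrr G₂) (λ τ → *-congˡ (ev-cong (SH ρ) (λ σ → reflexive (cong φ (reassociate G₁ π σ τ))))) ⟩
        ev (SIrr G₂) (λ τ → b * ev (SH ρ) (λ σ → φ ((G₁ ⊗D (π ⊗D σ)) ⊗D τ))) ∎

  ev-S⊗id-ΔFactors : ∀ {fs} → All Irr fs → ∀ φ → ev-S⊗id (ΔFactors fs) φ ≈ ⟦ null fs ⟧ (φ [])
  ev-S⊗id-ΔFactors [] φ = trans (+-identityʳ _) (trans (*-identityˡ _) (ev-H [] φ))
  ev-S⊗id-ΔFactors {f ∷ fs} (irr ∷ _) φ = ev-S⊗id-·T irr (ΔFactors fs) φ

  -- After the cancellation a term survives only for the empty list of factors, whereas the counit
  -- tests for order `0`.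
  null-factors : ∀ π → null (factors π) ≡ (length π ≡ᵇ 0)
  null-factors π = go (empty? π)
    where
    go : π ≡ [] ⊎ NonEmpty π → null (factors π) ≡ (length π ≡ᵇ 0)
    go (inj₁ ≡.refl) = ≡.refl
    go (inj₂ ne) = ≡.trans (not-null (factors π) (factors-≢[] π ne)) (≡.sym (positive π ne))
      where
      not-null : ∀ fs → fs ≢ [] → null {A = Diagram} fs ≡ false
      not-null [] fs≢ = ⊥-elim (fs≢ ≡.refl)
      not-null (_ ∷ _) _ = ≡.refl
      positive : ∀ π → NonEmpty π → (length π ≡ᵇ 0) ≡ false
      positive (_ ∷ _) _ = ≡.refl

  -- Coefficients, counit and conclusion

  sumK-filter : ∀ (p : K × Diagram → Bool) x → sumK (map proj₁ (filterᵇ p x)) ≈ ∑ x (λ q → ⟦ p q ⟧ (proj₁ q))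
  sumK-filter p [] = refl
  sumK-filter p (q ∷ x) with p q
  ... | true  = +-congˡ (sumK-filter p x)
  ... | false = trans (sumK-filter p x) (sym (+-identityˡ _))

  δ : Diagram → Diagram → K
  δ σ π = ⟦ π ≈D σ ⟧ 1#

  δ-invariant : ∀ σ → Invariant (δ σ)
  δ-invariant σ π = reflexive (cong (λ d → ⟦ does (d ≟D norm σ) ⟧ 1#) (norm-idem π))

  coeff-ev : ∀ x σ → coeff x σ ≈ ev x (δ σ)
  coeff-ev x σ = trans (sumK-filter _ x) (∑-cong x (λ (a , π) →
    trans (⟦⟧-cong (π ≈D σ) (λ _ → sym (*-identityʳ a))) (sym (*-⟦⟧ a (π ≈D σ) 1#))))

  ∑-Δ : ∀ x (F : K × Diagram × Diagram → K) → ∑ (Δ x) F ≈ ∑ x (λ (a , π) → ∑ (ΔH π) (λ (b , p) → F (a * b , p)))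
  ∑-Δ x F = trans (∑-concatMap _ x F) (∑-cong x (λ (a , π) → reflexive (∑-map _ (ΔH π) F)))

  ev-∇-S⊗id : ∀ t φ → ev (∇ (S⊗id t)) φ ≈ ev-S⊗id t φ
  ev-∇-S⊗id t φ = trans (reflexive (∑-map _ (S⊗id t) _)) (trans (∑-concatMap _ t _) (∑-cong t (λ (a , π , ρ) →
    trans (reflexive (∑-map _ (SH π) _)) (trans (∑-cong (SH π) (λ (b , σ) → *-assoc a b _)) (sym (*-∑ a (SH π) _))))))

  ev-∇-id⊗S : ∀ t φ → ev (∇ (id⊗S t)) φ ≈ ev-id⊗S t φ
  ev-∇-id⊗S t φ = trans (reflexive (∑-map _ (id⊗S t) _)) (trans (∑-concatMap _ t _) (∑-cong t (λ (a , π , ρ) →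
    trans (reflexive (∑-map _ (SH ρ) _)) (trans (∑-cong (SH ρ) (λ (b , σ) → *-assoc a b _)) (sym (*-∑ a (SH ρ) _))))))

  ev-η-ε : ∀ x φ → ev (η (ε x)) φ ≈ ∑ x (λ (a , π) → a * ⟦ length π ≡ᵇ 0 ⟧ (φ []))
  ev-η-ε x φ = begin
    ε x * φ [] + 0#                                                ≈⟨ +-identityʳ _ ⟩
    ε x * φ []                                                     ≈⟨ *-congʳ (sumK-filter _ x) ⟩
    ∑ x (λ (a , π) → ⟦ length π ≡ᵇ 0 ⟧ a) * φ []                   ≈⟨ *-comm _ _ ⟩
    φ [] * ∑ x (λ (a , π) → ⟦ length π ≡ᵇ 0 ⟧ a)                   ≈⟨ *-∑ (φ []) x _ ⟩
    ∑ x (λ (a , π) → φ [] * ⟦ length π ≡ᵇ 0 ⟧ a)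
      ≈⟨ ∑-cong x (λ (a , π) → trans (*-⟦⟧ (φ []) (length π ≡ᵇ 0) a)
           (trans (⟦⟧-cong (length π ≡ᵇ 0) (λ _ → *-comm (φ []) a)) (sym (*-⟦⟧ a (length π ≡ᵇ 0) (φ []))))) ⟩
    ∑ x (λ (a , π) → a * ⟦ length π ≡ᵇ 0 ⟧ (φ []))                 ∎

  S⊗id-antipode : ∀ x → ∇ (S⊗id (Δ x)) ≋ η (ε x)
  S⊗id-antipode x σ = begin
    coeff (∇ (S⊗id (Δ x))) σ          ≈⟨ coeff-ev (∇ (S⊗id (Δ x))) σ ⟩
    ev (∇ (S⊗id (Δ x))) (δ σ)         ≈⟨ ev-∇-S⊗id (Δ x) (δ σ) ⟩
    ev-S⊗id (Δ x) (δ σ)               ≈⟨ ∑-Δ x _ ⟩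
    ∑ x (λ (a , π) → ∑ (ΔH π) (λ (b , π₁ , π₂) → (a * b) * ev (SH π₁) (λ τ → δ σ (τ ⊗D π₂))))
      ≈⟨ ∑-cong x (λ (a , π) → trans (∑-cong (ΔH π) (λ (b , _) → *-assoc a b _)) (sym (*-∑ a (ΔH π) _))) ⟩
    ∑ x (λ (a , π) → a * ev-S⊗id (ΔH π) (δ σ))
      ≈⟨ ∑-cong x (λ (a , π) → *-congˡ (trans (ev-S⊗id-ΔFactors (factors-All π) (δ σ))
           (reflexive (cong (λ b → ⟦ b ⟧ (δ σ [])) (null-factors π))))) ⟩
    ∑ x (λ (a , π) → a * ⟦ length π ≡ᵇ 0 ⟧ (δ σ [])) ≈⟨ ev-η-ε x (δ σ) ⟨
    ev (η (ε x)) (δ σ)                ≈⟨ coeff-ev (η (ε x)) σ ⟨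
    coeff (η (ε x)) σ                 ∎

  id⊗S-antipode : ∀ x → ∇ (id⊗S (Δ x)) ≋ η (ε x)
  id⊗S-antipode x σ = begin
    coeff (∇ (id⊗S (Δ x))) σ          ≈⟨ coeff-ev (∇ (id⊗S (Δ x))) σ ⟩
    ev (∇ (id⊗S (Δ x))) (δ σ)         ≈⟨ ev-∇-id⊗S (Δ x) (δ σ) ⟩
    ev-id⊗S (Δ x) (δ σ)               ≈⟨ ∑-Δ x _ ⟩
    ∑ x (λ (a , π) → ∑ (ΔH π) (λ (b , π₁ , π₂) → (a * b) * ev (SH π₂) (λ τ → δ σ (π₁ ⊗D τ))))
      ≈⟨ ∑-cong x (λ (a , π) → trans (∑-cong (ΔH π) (λ (b , _) → *-assoc a b _)) (sym (*-∑ a (ΔH π) _))) ⟩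
    ∑ x (λ (a , π) → a * ev-id⊗S (ΔH π) (δ σ))
      ≈⟨ ∑-cong x (λ (a , π) → *-congˡ (trans (ev-id⊗S-ΔFactors (factors-All π) (δ-invariant σ))
           (reflexive (cong (λ b → ⟦ b ⟧ (δ σ [])) (null-factors π))))) ⟩
    ∑ x (λ (a , π) → a * ⟦ length π ≡ᵇ 0 ⟧ (δ σ [])) ≈⟨ ev-η-ε x (δ σ) ⟨
    ev (η (ε x)) (δ σ)                ≈⟨ coeff-ev (η (ε x)) σ ⟨
    coeff (η (ε x)) σ                 ∎

theorem3p12 : ∀ {c ℓ} (𝕜 : Field c ℓ) → let open ParSym (Field.commutativeRing 𝕜) in
    ∀ (x : V) → (∇ (S⊗id (Δ x)) ≋ η (ε x)) × (η (ε x) ≋ ∇ (id⊗S (Δ x)))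
theorem3p12 𝕜 x = S⊗id-antipode x , λ σ → sym (id⊗S-antipode x σ)
  where
  open Antipode (Field.commutativeRing 𝕜)
  open CommutativeRing (Field.commutativeRing 𝕜) using (sym)
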